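{- Let $m\ge2$ be an integer, let $a$ be real, and let $F_m$ be a real polynomial of degree $m$ with $F_m(0)=1$ whose zeros are real and equal to $-\alpha_1,\ldots,-\alpha_m$ (repeated according to multiplicity). (i) If $\alpha_j<a<1-m$ for $j=1,\ldots,m$, then all zeros of the polynomial $\hat{w}(a;F_m\,|\,x)$ are real and lie in the interval $(1,\infty)$. (ii) If $1-m<a<2-m$ and $\alpha_j<a$ for $j=1,\ldots,m$, then all zeros of $\hat{w}(a;F_m\,|\,x)$ but one lie in $(1,\infty)$, and the one remaining zero lies in $(0,1)$.
   Context: $(a)_n=a(a+1)\cdots(a+n-1)$, $(a)_0=1$, is the Pochhammer symbol. For real $a$ and a polynomial $F_m$ of degree $m$ with $F_m(0)=1$, the $F_m$-Eulerian polynomial $\hat{w}(x)=\hat{w}(a;F_m\,|\,x)$ is the polynomial in $x$ of degree at most $m$ defined by $$\sum_{n=0}^{\infty}F_m(n)\frac{(a)_n}{n!}x^n=\frac{\hat{w}(a;F_m\,|\,x)}{(1-x)^{m+a}},$$ where powers of $1-x$ are understood as power series at $0$. Zeros are counted with multiplicity. -}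

module Defs where

open import Algebra.Bundles using (CommutativeRing)
open import Algebra.Bundles.Raw using (RawRing)
open import Algebra.Core using (Op₁; Op₂)
import Algebra.Definitions.RawMonoid as RawMonoidDefs
open import Algebra.Structures using (IsCommutativeRing)
open import Data.Fin.Base using (Fin; toℕ)
open import Data.List.Base using (List; []; _∷_; foldr; map)
open import Data.Nat.Base as ℕ using (ℕ; zero; suc; _∸_; _!)
open import Data.Product.Base using (Σ-syntax; ∃-syntax; _×_)
open import Level using (0ℓ)
open import Relation.Binary.Core using (Rel)
import Relation.Binary.Construct.StrictToNonStrict as ToNonStrict
open import Relation.Binary.Structures using (IsStrictTotalOrder)
open import Relation.Nullary using (¬_)
open import Relation.Unary using (Pred; _∈_)

-- The axioms characterising ℝ up to isomorphism, read classically: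
-- trichotomy of the order is data.
record CompleteOrderedField : Set₁ where
  infix  9 _⁻¹
  infix  8 -_
  infixl 7 _*_ _/_
  infixl 6 _+_
  infix  4 _≈_ _<_
  field
    Carrier : Set
    _≈_     : Rel Carrier 0ℓ
    _<_     : Rel Carrier 0ℓ
    _+_     : Op₂ Carrier
    _*_     : Op₂ Carrier
    -_      : Op₁ Carrier
    0#      : Carrier
    1#      : Carrier
    -- Total; nothing but congruence is assumed about 0# ⁻¹.
    _⁻¹     : Op₁ Carrier

    isCommutativeRing  : IsCommutativeRing _≈_ _+_ _*_ -_ 0# 1#
    0≉1                : ¬ (0# ≈ 1#)
    ⁻¹-cong            : ∀ {x y} → x ≈ y → x ⁻¹ ≈ y ⁻¹
    ⁻¹-inverseʳ        : ∀ x → ¬ (x ≈ 0#) → x * x ⁻¹ ≈ 1#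
    isStrictTotalOrder : IsStrictTotalOrder _≈_ _<_
    +-monoʳ-<          : ∀ x {y z} → y < z → x + y < x + z
    *-pos              : ∀ {x y} → 0# < x → 0# < y → 0# < x * y

  open ToNonStrict _≈_ _<_ public using (_≤_)

  UpperBound : Pred Carrier 0ℓ → Carrier → Set
  UpperBound P b = ∀ x → x ∈ P → x ≤ b

  Supremum : Pred Carrier 0ℓ → Carrier → Set
  Supremum P s = UpperBound P s × (∀ b → UpperBound P b → s ≤ b)

  field
    supremum : ∀ P → (∃[ x ] (x ∈ P)) → (∃[ b ] UpperBound P b) → ∃[ s ] Supremum P s

  commutativeRing : CommutativeRing 0ℓ 0ℓ
  commutativeRing = record { isCommutativeRing = isCommutativeRing }

  open CommutativeRing commutativeRing public
    using (_≉_; _-_; rawRing; +-rawMonoid)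

  _/_ : Op₂ Carrier
  x / y = x * y ⁻¹

-- A polynomial is the list of its coefficients, constant term first;
-- trailing zeros are allowed, so equality is _≈ₚ_.
module Polynomials {c ℓ} (R : RawRing c ℓ) where
  open RawRing R

  infix  4 _≈ₚ_
  infixl 6 _+ₚ_
  infixl 7 _*ₚ_ _·ₚ_

  Poly : Set c
  Poly = List Carrier

  coeff : Poly → ℕ → Carrier
  coeff []      _       = 0#
  coeff (x ∷ p) zero    = x
  coeff (x ∷ p) (suc n) = coeff p n

  _≈ₚ_ : Rel Poly ℓ
  p ≈ₚ q = ∀ n → coeff p n ≈ coeff q n

  DegreeAtMost : Poly → ℕ → Set ℓ
  DegreeAtMost p d = ∀ n → d ℕ.< n → coeff p n ≈ 0#

  HasDegree : Poly → ℕ → Set ℓ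
  HasDegree p d = coeff p d ≉ 0# × DegreeAtMost p d

  eval : Poly → Carrier → Carrier
  eval []      x = 0#
  eval (a ∷ p) x = a + x * eval p x

  _+ₚ_ : Op₂ Poly
  []      +ₚ q       = q
  (a ∷ p) +ₚ []      = a ∷ p
  (a ∷ p) +ₚ (b ∷ q) = (a + b) ∷ (p +ₚ q)

  _·ₚ_ : Carrier → Poly → Poly
  a ·ₚ p = map (a *_) p

  _*ₚ_ : Op₂ Poly
  []      *ₚ q = []
  (a ∷ p) *ₚ q = a ·ₚ q +ₚ (0# ∷ p *ₚ q)

  -- ∏ (X − z) over the list
  monicWithZeros : List Carrier → Poly
  monicWithZeros = foldr (λ z p → (- z ∷ 1# ∷ []) *ₚ p) (1# ∷ [])

  -- p is c ∏ (X − z) with c ≠ 0.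
  FactorsWithZeros : Poly → List Carrier → Set _
  FactorsWithZeros p zs = Σ[ c ∈ Carrier ] (c ≉ 0# × p ≈ₚ c ·ₚ monicWithZeros zs)

module Eulerian (ℝ : CompleteOrderedField) where
  open CompleteOrderedField ℝ
  private module ℝ = RawMonoidDefs +-rawMonoid

  open Polynomials rawRing public

  infix 6 _+i_

  record ℂ : Set where
    constructor _+i_
    field
      re im : Carrier

  open ℂ public

  ℂ-rawRing : RawRing 0ℓ 0ℓ
  ℂ-rawRing = record
    { Carrier = ℂ
    ; _≈_     = λ z w → re z ≈ re w × im z ≈ im w
    ; _+_     = λ z w → (re z + re w) +i (im z + im w)
    ; _*_     = λ z w → (re z * re w - im z * im w) +i (re z * im w + im z * re w)
    ; -_      = λ z → (- re z) +i (- im z)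
    ; 0#      = 0# +i 0#
    ; 1#      = 1# +i 0#
    }

  module ℂ[X] = Polynomials ℂ-rawRing

  ofReal : Carrier → ℂ
  ofReal x = x +i 0#

  -- zs lists all complex zeros of the real polynomial p, each repeated
  -- according to its multiplicity.
  ComplexZeros : Poly → List ℂ → Set
  ComplexZeros p zs = ℂ[X].FactorsWithZeros (map ofReal p) zs

  fromℕ : ℕ → Carrier
  fromℕ n = n ℝ.× 1#

  pochhammer : Carrier → ℕ → Carrier
  pochhammer a zero    = 1#
  pochhammer a (suc n) = pochhammer a n * (a + fromℕ n)

  PowerSeries : Set
  PowerSeries = ℕ → Carrier

  infixl 7 _⊛_

  _⊛_ : Op₂ PowerSeries
  (f ⊛ g) n = ℝ.sum {suc n} λ (k : Fin (suc n)) → f (toℕ k) * g (n ∸ toℕ k)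

  -- The binomial series (1 − x)^s = Σ (−s)ₙ/n! xⁿ.
  [1-x]^ : Carrier → PowerSeries
  [1-x]^ s n = pochhammer (- s) n / fromℕ (n !)

  -- w is ŵ(a; F | x), for F of degree m. Dividing by (1 − x)^(m+a) is
  -- multiplying by (1 − x)^(−(m+a)).
  IsEulerianPolynomial : ℕ → Carrier → Poly → Poly → Set
  IsEulerianPolynomial m a F w =
    DegreeAtMost w m ×
    (∀ n → eval F (fromℕ n) * (pochhammer a n / fromℕ (n !))
           ≈ (coeff w ⊛ [1-x]^ (- (fromℕ m + a))) n)

{-# OPTIONS --safe #-}
module Submission where

-- Multiplying F by X + α multiplies the n-th coefficient of its generating
-- series by α + n, that is, applies the operator α + x d/dx. On the numerator w
-- over the power s of 1 − x this operator becomes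
--   w  ↦  (α (1 − x) + s x) w + x (1 − x) w',
-- and the power becomes s + 1 (step-series). Thus the Eulerian polynomial arises
-- from the constant 1 by m such steps, with s = a + k in the step numbered
-- k = 0, …, m − 1, up to a constant factor (eulerian-unique).
--
-- In one step let W be the old and V the new polynomial, of degrees k and k + 1.
-- Then V(0) = α W(0) and V(1) = s W(1), the leading coefficient of V is a − α > 0
-- times that of W, and V(z) = z (1 − z) W'(z) at each zero z of W. Suppose that W
-- has k simple zeros above 1. The signs of W' alternate along the zeros, so V
-- alternates along a large number, the zeros of W in descending order and, if
-- s < 0, the point 1 (alternates-at-zeros). By the intermediate value theorem V
-- has k + 1 simple zeros above 1 if s < 0 (zeros-step). If a < 1 − m, this is so in
-- all steps. If 1 − m < a < 2 − m, it is so in all steps but the last; in that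
-- one s > 0, and V still has k zeros above 1, while V(0) V(1) = α s W(0) W(1) is
-- negative, which places one more zero in (0, 1) (zeros-last-step); here
-- W(0) W(1) > 0 because the earlier steps multiplied this product by positive
-- numbers α s. As V has degree at most k + 1, these are all its zeros (factor).
--
-- The intermediate value theorem for polynomials is deduced from the existence
-- of suprema, using that a polynomial is Lipschitz on bounded intervals.

open import Defs
open import Algebra.Bundles using (CommutativeRing)
open import Data.Empty using (⊥; ⊥-elim)
open import Data.Fin.Base using (Fin)
open import Data.List.Base using (List; []; _∷_; _++_; map; tabulate; length)
open import Data.List.Properties using (length-++; length-tabulate; map-tabulate)
open import Data.List.Relation.Binary.Pointwise as Pointwise using (Pointwise; []; _∷_)
open import Data.List.Relation.Unary.All as All using (All; []; _∷_)
import Data.List.Relation.Unary.All.Properties as All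
open import Data.List.Relation.Unary.AllPairs as AllPairs using (AllPairs; []; _∷_)
import Data.List.Relation.Unary.AllPairs.Properties as AllPairs
open import Data.Nat.Base as ℕ using (ℕ; zero; suc; _!)
import Data.Nat.Properties as ℕ
open import Data.Product.Base using (_×_; Σ-syntax; ∃-syntax; _,_; proj₁; proj₂)
open import Data.Sum.Base using (inj₁; inj₂)
open import Data.Unit.Base using (⊤; tt)
open import Relation.Binary.Definitions using (tri<; tri≈; tri>)
open import Relation.Binary.PropositionalEquality.Core as ≡ using (_≡_)
open import Relation.Binary.Structures using (IsStrictTotalOrder)

-- A ring solver with integer coefficients for abstract commutative rings

module IntegerSolver {c ℓ} (R : CommutativeRing c ℓ) where
  open CommutativeRing R
  open import Algebra.Properties.Ring ring
  open import Algebra.Properties.AbelianGroup +-abelianGroup using (⁻¹-∙-comm)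
  open import Algebra.Properties.Semiring.Mult.TCOptimised semiring
    renaming (_×_ to _⋆_)
  open import Algebra.Solver.Ring.AlmostCommutativeRing
  open import Data.Integer.Base as ℤ using (ℤ; +_; -[1+_]; _⊖_; _◃_)
  import Data.Integer.Properties as ℤ
  open import Data.Sign.Base as Sign using (Sign)
  open import Relation.Binary.Consequences using (dec⇒weaklyDec)
  open import Data.Maybe.Base using (Maybe)
  import Data.Maybe.Base as Maybe
  open import Relation.Binary.Reasoning.Setoid setoid

  -- The canonical map from the integers.
  ⟦_⟧ : ℤ → Carrier
  ⟦ + n ⟧      = n ⋆ 1#
  ⟦ -[1+ n ] ⟧ = - (suc n ⋆ 1#)

  ⟦⊖⟧ : ∀ m n → ⟦ m ⊖ n ⟧ ≈ m ⋆ 1# - n ⋆ 1#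
  ⟦⊖⟧ m zero = sym (trans (+-congˡ -0#≈0#) (+-identityʳ _))
  ⟦⊖⟧ zero (suc n) = sym (+-identityˡ _)
  ⟦⊖⟧ (suc m) (suc n) = begin
    ⟦ suc m ⊖ suc n ⟧                      ≡⟨ ≡.cong ⟦_⟧ (ℤ.[1+m]⊖[1+n]≡m⊖n m n) ⟩
    ⟦ m ⊖ n ⟧                              ≈⟨ ⟦⊖⟧ m n ⟩
    m ⋆ 1# - n ⋆ 1#                        ≈⟨ +-congʳ (+-identityˡ _) ⟨
    0# + m ⋆ 1# - n ⋆ 1#                   ≈⟨ +-congʳ (+-congʳ (-‿inverseʳ 1#)) ⟨
    1# - 1# + m ⋆ 1# - n ⋆ 1#              ≈⟨ +-congʳ (+-assoc _ _ _) ⟩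
    1# + (- 1# + m ⋆ 1#) - n ⋆ 1#          ≈⟨ +-congʳ (+-congˡ (+-comm _ _)) ⟩
    1# + (m ⋆ 1# - 1#) - n ⋆ 1#            ≈⟨ +-congʳ (+-assoc _ _ _) ⟨
    1# + m ⋆ 1# - 1# - n ⋆ 1#              ≈⟨ +-assoc _ _ _ ⟩
    1# + m ⋆ 1# + (- 1# - n ⋆ 1#)          ≈⟨ +-cong (1+× m 1#) (trans (-‿cong (1+× n 1#)) (sym (⁻¹-∙-comm _ _))) ⟨
    suc m ⋆ 1# - suc n ⋆ 1#                ∎

  ⟦-◃⟧ : ∀ k → ⟦ Sign.- ◃ k ⟧ ≈ - (k ⋆ 1#)
  ⟦-◃⟧ zero    = sym -0#≈0#
  ⟦-◃⟧ (suc k) = refl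

  ⟦+◃⟧ : ∀ k → ⟦ Sign.+ ◃ k ⟧ ≈ k ⋆ 1#
  ⟦+◃⟧ k = reflexive (≡.cong ⟦_⟧ (ℤ.+◃n≡+n k))

  +-homo : ∀ i j → ⟦ i ℤ.+ j ⟧ ≈ ⟦ i ⟧ + ⟦ j ⟧
  +-homo (+ m)    (+ n)    = ×-homo-+ 1# m n
  +-homo (+ m)    -[1+ n ] = ⟦⊖⟧ m (suc n)
  +-homo -[1+ m ] (+ n)    = trans (⟦⊖⟧ n (suc m)) (+-comm _ _)
  +-homo -[1+ m ] -[1+ n ] = begin
    - (suc (suc (m ℕ.+ n)) ⋆ 1#)     ≡⟨ ≡.cong (λ k → - (suc k ⋆ 1#)) (ℕ.+-suc m n) ⟨
    - ((suc m ℕ.+ suc n) ⋆ 1#)       ≈⟨ -‿cong (×-homo-+ 1# (suc m) (suc n)) ⟩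
    - (suc m ⋆ 1# + suc n ⋆ 1#)      ≈⟨ ⁻¹-∙-comm _ _ ⟨
    - (suc m ⋆ 1#) - suc n ⋆ 1#      ∎

  *-homo : ∀ i j → ⟦ i ℤ.* j ⟧ ≈ ⟦ i ⟧ * ⟦ j ⟧
  *-homo (+ m)    (+ n)    = trans (⟦+◃⟧ (m ℕ.* n)) (×1-homo-* m n)
  *-homo (+ m)    -[1+ n ] = begin
    ⟦ Sign.- ◃ m ℕ.* suc n ⟧   ≈⟨ ⟦-◃⟧ (m ℕ.* suc n) ⟩
    - ((m ℕ.* suc n) ⋆ 1#)     ≈⟨ -‿cong (×1-homo-* m (suc n)) ⟩
    - (m ⋆ 1# * suc n ⋆ 1#)    ≈⟨ -‿distribʳ-* _ _ ⟩
    m ⋆ 1# * - (suc n ⋆ 1#)    ∎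
  *-homo -[1+ m ] (+ n)    = begin
    ⟦ Sign.- ◃ suc m ℕ.* n ⟧   ≈⟨ ⟦-◃⟧ (suc m ℕ.* n) ⟩
    - ((suc m ℕ.* n) ⋆ 1#)     ≈⟨ -‿cong (×1-homo-* (suc m) n) ⟩
    - (suc m ⋆ 1# * n ⋆ 1#)    ≈⟨ -‿distribˡ-* _ _ ⟩
    - (suc m ⋆ 1#) * n ⋆ 1#    ∎
  *-homo -[1+ m ] -[1+ n ] = begin
    (suc m ℕ.* suc n) ⋆ 1#             ≈⟨ ×1-homo-* (suc m) (suc n) ⟩
    suc m ⋆ 1# * suc n ⋆ 1#            ≈⟨ -‿involutive _ ⟨
    - - (suc m ⋆ 1# * suc n ⋆ 1#)      ≈⟨ -‿cong (-‿distribʳ-* _ _) ⟩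
    - (suc m ⋆ 1# * - (suc n ⋆ 1#))    ≈⟨ -‿distribˡ-* _ _ ⟩
    - (suc m ⋆ 1#) * - (suc n ⋆ 1#)    ∎

  -‿homo : ∀ i → ⟦ ℤ.- i ⟧ ≈ - ⟦ i ⟧
  -‿homo (+ zero)    = sym -0#≈0#
  -‿homo (+ (suc n)) = refl
  -‿homo -[1+ n ]    = sym (-‿involutive _)

  almostCommutativeRing : AlmostCommutativeRing c ℓ
  almostCommutativeRing = fromCommutativeRing R

  ℤ⟶R : ℤ.+-*-rawRing -Raw-AlmostCommutative⟶ almostCommutativeRing
  ℤ⟶R = record
    { ⟦_⟧ = ⟦_⟧ ; +-homo = +-homo ; *-homo = *-homo ; -‿homo = -‿homo
    ; 0-homo = refl ; 1-homo = refl }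

  ≟-sound : ∀ i j → Maybe (⟦ i ⟧ ≈ ⟦ j ⟧)
  ≟-sound i j = Maybe.map (λ i≡j → reflexive (≡.cong ⟦_⟧ i≡j)) (dec⇒weaklyDec ℤ._≟_ i j)

  open import Algebra.Solver.Ring ℤ.+-*-rawRing almostCommutativeRing ℤ⟶R ≟-sound public
    using (Polynomial; con; solve; _:=_; _:+_; _:*_; _:-_; :-_)

  -- The constants 0 and 1 as solver expressions.
  :0 :1 : ∀ {n} → Polynomial n
  :0 = con (+ 0)
  :1 = con (+ 1)

-- Inequalities in an ordered field

module OrderedField (ℝ : CompleteOrderedField) where
  open CompleteOrderedField ℝ
  open CommutativeRing commutativeRing public using
    ( refl; sym; trans; +-cong; +-congˡ; +-congʳ; *-cong; *-congˡ; *-congʳ; -‿cong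
    ; *-comm; *-assoc; +-comm; +-assoc; zeroʳ; zeroˡ; setoid; semiring
    ; +-identityˡ; +-identityʳ; *-identityˡ; *-identityʳ; -‿inverseʳ)
  module S = IntegerSolver commutativeRing
  open S public using (solve; _:=_; _:+_; _:*_; _:-_; :-_; :0; :1)
  open IsStrictTotalOrder isStrictTotalOrder public using (compare; <-respˡ-≈; <-respʳ-≈; irrefl)
    renaming (trans to <-trans; asym to <-asym)

  -- An inequality x < y is handled as the positivity of y − x, so that
  -- proofs combine products of positive quantities and a ring identity.

  pos-resp : ∀ {x y} → x ≈ y → 0# < x → 0# < y
  pos-resp = <-respʳ-≈

  gap : ∀ {x y} → x < y → 0# < y - x
  gap {x} {y} x<y =
    <-respˡ-≈ (solve 1 (λ x → :- x :+ x := :0) refl x)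
      (<-respʳ-≈ (+-comm (- x) y) (+-monoʳ-< (- x) x<y))

  ungap : ∀ {x y} → 0# < y - x → x < y
  ungap {x} {y} 0<d =
    <-respˡ-≈ (+-identityʳ x)
      (<-respʳ-≈ (solve 2 (λ x y → x :+ (y :- x) := y) refl x y) (+-monoʳ-< x 0<d))

  -- x < y, from a positive expression for y − x
  by-gap : ∀ {x y d} → d ≈ y - x → 0# < d → x < y
  by-gap d≈ 0<d = ungap (pos-resp d≈ 0<d)

  +-pos : ∀ {x y} → 0# < x → 0# < y → 0# < x + y
  +-pos {x} 0<x 0<y = <-trans 0<x (<-respˡ-≈ (+-identityʳ x) (+-monoʳ-< x 0<y))

  neg⇒pos : ∀ {x} → x < 0# → 0# < - x
  neg⇒pos {x} x<0 = pos-resp (+-identityˡ (- x)) (gap x<0)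

  neg*neg : ∀ {x y} → x < 0# → y < 0# → 0# < x * y
  neg*neg {x} {y} x<0 y<0 =
    pos-resp (solve 2 (λ x y → :- x :* :- y := x :* y) refl x y)
      (*-pos (neg⇒pos x<0) (neg⇒pos y<0))

  square-pos : ∀ {x} → x ≉ 0# → 0# < x * x
  square-pos {x} x≉0 with compare x 0#
  ... | tri< x<0 _ _ = neg*neg x<0 x<0
  ... | tri≈ _ x≈0 _ = ⊥-elim (x≉0 x≈0)
  ... | tri> _ _ 0<x = *-pos 0<x 0<x

  0<1 : 0# < 1#
  0<1 = pos-resp (*-identityˡ 1#) (square-pos (λ 1≈0 → 0≉1 (sym 1≈0)))

  pos⇒≉0 : ∀ {x} → 0# < x → x ≉ 0#
  pos⇒≉0 0<x x≈0 = irrefl (sym x≈0) 0<x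

  pos-cancelˡ : ∀ {x y} → 0# < x → 0# < x * y → 0# < y
  pos-cancelˡ {x} {y} 0<x 0<xy with compare y 0#
  ... | tri> _ _ 0<y = 0<y
  ... | tri≈ _ y≈0 _ = ⊥-elim (pos⇒≉0 0<xy (trans (*-congˡ y≈0) (zeroʳ x)))
  ... | tri< y<0 _ _ = ⊥-elim (<-asym 0<xy
          (by-gap (solve 2 (λ x y → x :* :- y := :0 :- x :* y) refl x y) (*-pos 0<x (neg⇒pos y<0))))

  *-cancelˡ : ∀ {x y z} → x ≉ 0# → x * y ≈ x * z → y ≈ z
  *-cancelˡ {x} {y} {z} x≉0 xy≈xz = trans (expand y) (trans (*-congˡ xy≈xz) (sym (expand z)))
    where
    expand : ∀ u → u ≈ x ⁻¹ * (x * u)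
    expand u = trans (sym (*-identityˡ u)) (trans (*-congʳ (sym (⁻¹-inverseʳ x x≉0)))
      (solve 3 (λ x i u → x :* i :* u := i :* (x :* u)) refl x (x ⁻¹) u))

  ⁻¹-pos : ∀ {x} → 0# < x → 0# < x ⁻¹
  ⁻¹-pos {x} 0<x = pos-cancelˡ 0<x (pos-resp (sym (⁻¹-inverseʳ x (pos⇒≉0 0<x))) 0<1)

  -- The same for x ≤ y, read as 0 ≤ y − x.

  <⇒≤ : ∀ {x y} → x < y → x ≤ y
  <⇒≤ = inj₁

  ≈⇒≤ : ∀ {x y} → x ≈ y → x ≤ y
  ≈⇒≤ = inj₂

  ≤-refl : ∀ {x} → x ≤ x
  ≤-refl = inj₂ refl

  nonneg-resp : ∀ {x y} → x ≈ y → 0# ≤ x → 0# ≤ y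
  nonneg-resp x≈y (inj₁ 0<x) = inj₁ (pos-resp x≈y 0<x)
  nonneg-resp x≈y (inj₂ 0≈x) = inj₂ (trans 0≈x x≈y)

  gap≤ : ∀ {x y} → x ≤ y → 0# ≤ y - x
  gap≤ (inj₁ x<y) = inj₁ (gap x<y)
  gap≤ {x} {y} (inj₂ x≈y) = inj₂ (sym (trans (+-congʳ (sym x≈y)) (-‿inverseʳ x)))

  by-gap≤ : ∀ {x y d} → d ≈ y - x → 0# ≤ d → x ≤ y
  by-gap≤ d≈ (inj₁ 0<d) = inj₁ (by-gap d≈ 0<d)
  by-gap≤ {x} {y} d≈ (inj₂ 0≈d) = inj₂ (trans (sym (+-identityʳ x)) (trans (+-congˡ (trans 0≈d d≈))
    (solve 2 (λ x y → x :+ (y :- x) := y) refl x y)))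

  pos+nonneg : ∀ {x y} → 0# < x → 0# ≤ y → 0# < x + y
  pos+nonneg 0<x (inj₁ 0<y) = +-pos 0<x 0<y
  pos+nonneg {x} 0<x (inj₂ 0≈y) = pos-resp (trans (sym (+-identityʳ x)) (+-congˡ 0≈y)) 0<x

  +-nonneg : ∀ {x y} → 0# ≤ x → 0# ≤ y → 0# ≤ x + y
  +-nonneg (inj₁ 0<x) 0≤y = inj₁ (pos+nonneg 0<x 0≤y)
  +-nonneg {x} {y} (inj₂ 0≈x) 0≤y = nonneg-resp (trans (sym (+-identityˡ y)) (+-congʳ 0≈x)) 0≤y

  *-nonneg : ∀ {x y} → 0# ≤ x → 0# ≤ y → 0# ≤ x * y
  *-nonneg (inj₁ 0<x) (inj₁ 0<y) = inj₁ (*-pos 0<x 0<y)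
  *-nonneg {x} {y} (inj₁ 0<x) (inj₂ 0≈y) = inj₂ (trans (sym (zeroʳ x)) (*-congˡ 0≈y))
  *-nonneg {x} {y} (inj₂ 0≈x) _ = inj₂ (trans (sym (zeroˡ y)) (*-congʳ 0≈x))

  ≤-trans : ∀ {x y z} → x ≤ y → y ≤ z → x ≤ z
  ≤-trans {x} {y} {z} x≤y y≤z = by-gap≤
    (solve 3 (λ x y z → (y :- x) :+ (z :- y) := z :- x) refl x y z) (+-nonneg (gap≤ x≤y) (gap≤ y≤z))

  <-≤-trans : ∀ {x y z} → x < y → y ≤ z → x < z
  <-≤-trans {x} {y} {z} x<y y≤z = by-gap
    (solve 3 (λ x y z → (y :- x) :+ (z :- y) := z :- x) refl x y z) (pos+nonneg (gap x<y) (gap≤ y≤z))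

  ≤-<-trans : ∀ {x y z} → x ≤ y → y < z → x < z
  ≤-<-trans {x} {y} {z} x≤y y<z = by-gap
    (solve 3 (λ x y z → (z :- y) :+ (y :- x) := z :- x) refl x y z) (pos+nonneg (gap y<z) (gap≤ x≤y))

  <-irrefl : ∀ {x} → x < x → ⊥
  <-irrefl = irrefl refl

-- Polynomials: coefficients, values, derivatives and linear factors

module PolynomialAlgebra (ℝ : CompleteOrderedField) where
  open CompleteOrderedField ℝ
  open Eulerian ℝ
  open OrderedField ℝ
  open import Relation.Binary.Reasoning.Setoid setoid

  -- The polynomial X − z.
  X-_ : Carrier → Poly
  X- z = - z ∷ 1# ∷ []

  coeff-+ : ∀ p q n → coeff (p +ₚ q) n ≈ coeff p n + coeff q n
  coeff-+ []      q       n       = sym (+-identityˡ _)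
  coeff-+ (a ∷ p) []      n       = sym (+-identityʳ _)
  coeff-+ (a ∷ p) (b ∷ q) zero    = refl
  coeff-+ (a ∷ p) (b ∷ q) (suc n) = coeff-+ p q n

  coeff-· : ∀ c p n → coeff (c ·ₚ p) n ≈ c * coeff p n
  coeff-· c []      n       = sym (zeroʳ c)
  coeff-· c (a ∷ p) zero    = refl
  coeff-· c (a ∷ p) (suc n) = coeff-· c p n

  coeff-[0] : ∀ n → coeff (0# ∷ []) n ≈ 0#
  coeff-[0] zero    = refl
  coeff-[0] (suc n) = refl

  coeff-linear-zero : ∀ z p → coeff ((X- z) *ₚ p) 0 ≈ - z * coeff p 0
  coeff-linear-zero z p = begin
    coeff ((X- z) *ₚ p) 0           ≈⟨ coeff-+ (- z ·ₚ p) _ 0 ⟩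
    coeff (- z ·ₚ p) 0 + 0#         ≈⟨ +-identityʳ _ ⟩
    coeff (- z ·ₚ p) 0              ≈⟨ coeff-· (- z) p 0 ⟩
    - z * coeff p 0                 ∎

  coeff-linear-suc : ∀ z p n → coeff ((X- z) *ₚ p) (suc n) ≈ coeff p n - z * coeff p (suc n)
  coeff-linear-suc z p n = begin
    coeff ((X- z) *ₚ p) (suc n)
      ≈⟨ coeff-+ (- z ·ₚ p) _ (suc n) ⟩
    coeff (- z ·ₚ p) (suc n) + coeff (1# ·ₚ p +ₚ (0# ∷ [])) n
      ≈⟨ +-cong (coeff-· (- z) p (suc n)) (coeff-+ (1# ·ₚ p) _ n) ⟩
    - z * coeff p (suc n) + (coeff (1# ·ₚ p) n + coeff (0# ∷ []) n)
      ≈⟨ +-congˡ (+-cong (coeff-· 1# p n) (coeff-[0] n)) ⟩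
    - z * coeff p (suc n) + (1# * coeff p n + 0#)
      ≈⟨ solve 3 (λ z u v → :- z :* u :+ (:1 :* v :+ :0) := v :- z :* u) refl z (coeff p (suc n)) (coeff p n) ⟩
    coeff p n - z * coeff p (suc n) ∎

  linear-cong : ∀ z p q → p ≈ₚ q → (X- z) *ₚ p ≈ₚ (X- z) *ₚ q
  linear-cong z p q e zero = trans (coeff-linear-zero z p) (trans (*-congˡ (e 0)) (sym (coeff-linear-zero z q)))
  linear-cong z p q e (suc n) = trans (coeff-linear-suc z p n)
    (trans (+-cong (e n) (-‿cong (*-congˡ (e (suc n))))) (sym (coeff-linear-suc z q n)))

  -- The formal derivative, evaluated at a point.
  deriv : Poly → Carrier → Carrier
  deriv []      x = 0#
  deriv (a ∷ p) x = eval p x + x * deriv p x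

  eval-cong : ∀ p q x → p ≈ₚ q → eval p x ≈ eval q x
  eval-cong []      []      x e = refl
  eval-cong []      (b ∷ q) x e = trans (sym (+-identityˡ _))
    (+-cong (e 0) (trans (sym (zeroʳ x)) (*-congˡ (eval-cong [] q x (λ n → e (suc n))))))
  eval-cong (a ∷ p) []      x e = trans
    (+-cong (e 0) (trans (*-congˡ (eval-cong p [] x (λ n → e (suc n)))) (zeroʳ x))) (+-identityˡ _)
  eval-cong (a ∷ p) (b ∷ q) x e = +-cong (e 0) (*-congˡ (eval-cong p q x (λ n → e (suc n))))

  deriv-cong : ∀ p q x → p ≈ₚ q → deriv p x ≈ deriv q x
  deriv-cong []      []      x e = refl
  deriv-cong []      (b ∷ q) x e = trans (sym (+-identityˡ _))
    (+-cong (eval-cong [] q x (λ n → e (suc n)))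
      (trans (sym (zeroʳ x)) (*-congˡ (deriv-cong [] q x (λ n → e (suc n))))))
  deriv-cong (a ∷ p) []      x e = trans
    (+-cong (eval-cong p [] x (λ n → e (suc n)))
      (trans (*-congˡ (deriv-cong p [] x (λ n → e (suc n)))) (zeroʳ x))) (+-identityˡ _)
  deriv-cong (a ∷ p) (b ∷ q) x e =
    +-cong (eval-cong p q x (λ n → e (suc n))) (*-congˡ (deriv-cong p q x (λ n → e (suc n))))

  eval-+ : ∀ p q x → eval (p +ₚ q) x ≈ eval p x + eval q x
  eval-+ []      q       x = sym (+-identityˡ _)
  eval-+ (a ∷ p) []      x = sym (+-identityʳ _)
  eval-+ (a ∷ p) (b ∷ q) x = trans (+-congˡ (*-congˡ (eval-+ p q x)))
    (solve 5 (λ a b x u v → (a :+ b) :+ x :* (u :+ v) := (a :+ x :* u) :+ (b :+ x :* v)) refl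
      a b x (eval p x) (eval q x))

  deriv-+ : ∀ p q x → deriv (p +ₚ q) x ≈ deriv p x + deriv q x
  deriv-+ []      q       x = sym (+-identityˡ _)
  deriv-+ (a ∷ p) []      x = sym (+-identityʳ _)
  deriv-+ (a ∷ p) (b ∷ q) x = trans (+-cong (eval-+ p q x) (*-congˡ (deriv-+ p q x)))
    (solve 5 (λ a b x u v → (a :+ b) :+ x :* (u :+ v) := (a :+ x :* u) :+ (b :+ x :* v)) refl
      (eval p x) (eval q x) x (deriv p x) (deriv q x))

  eval-· : ∀ c p x → eval (c ·ₚ p) x ≈ c * eval p x
  eval-· c []      x = sym (zeroʳ c)
  eval-· c (a ∷ p) x = trans (+-congˡ (*-congˡ (eval-· c p x)))
    (solve 4 (λ c a x u → c :* a :+ x :* (c :* u) := c :* (a :+ x :* u)) refl c a x (eval p x))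

  deriv-· : ∀ c p x → deriv (c ·ₚ p) x ≈ c * deriv p x
  deriv-· c []      x = sym (zeroʳ c)
  deriv-· c (a ∷ p) x = trans (+-cong (eval-· c p x) (*-congˡ (deriv-· c p x)))
    (solve 4 (λ c a x u → c :* a :+ x :* (c :* u) := c :* (a :+ x :* u)) refl c (eval p x) x (deriv p x))

  eval-linear : ∀ z p x → eval ((X- z) *ₚ p) x ≈ (x - z) * eval p x
  eval-linear z p x = begin
    eval ((X- z) *ₚ p) x
      ≈⟨ eval-+ (- z ·ₚ p) _ x ⟩
    eval (- z ·ₚ p) x + (0# + x * eval (1# ·ₚ p +ₚ (0# ∷ [])) x)
      ≈⟨ +-cong (eval-· (- z) p x) (+-congˡ (*-congˡ (trans (eval-+ (1# ·ₚ p) _ x) (+-congʳ (eval-· 1# p x))))) ⟩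
    - z * eval p x + (0# + x * (1# * eval p x + (0# + x * 0#)))
      ≈⟨ solve 3 (λ z x u → :- z :* u :+ (:0 :+ x :* (:1 :* u :+ (:0 :+ x :* :0))) := (x :- z) :* u) refl
           z x (eval p x) ⟩
    (x - z) * eval p x ∎

  deriv-linear : ∀ z p x → deriv ((X- z) *ₚ p) x ≈ eval p x + (x - z) * deriv p x
  deriv-linear z p x = begin
    deriv ((X- z) *ₚ p) x
      ≈⟨ deriv-+ (- z ·ₚ p) _ x ⟩
    deriv (- z ·ₚ p) x + (eval (1# ·ₚ p +ₚ (0# ∷ [])) x + x * deriv (1# ·ₚ p +ₚ (0# ∷ [])) x)
      ≈⟨ +-cong (deriv-· (- z) p x) (+-cong (trans (eval-+ (1# ·ₚ p) _ x) (+-congʳ (eval-· 1# p x)))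
           (*-congˡ (trans (deriv-+ (1# ·ₚ p) _ x) (+-congʳ (deriv-· 1# p x))))) ⟩
    - z * deriv p x + ((1# * eval p x + (0# + x * 0#)) + x * (1# * deriv p x + (0# + x * 0#)))
      ≈⟨ solve 4 (λ z x u v → :- z :* v :+ ((:1 :* u :+ (:0 :+ x :* :0)) :+ x :* (:1 :* v :+ (:0 :+ x :* :0)))
                := u :+ (x :- z) :* v) refl z x (eval p x) (deriv p x) ⟩
    eval p x + (x - z) * deriv p x ∎

  -- The quotient of p by X − r, by Horner's scheme: its coefficients are the
  -- values at r of the tails of p, and the remainder eval p r is dropped.
  quotient : Poly → Carrier → Poly
  quotient []      r = []
  quotient (a ∷ p) r = eval p r ∷ quotient p r

  coeff-quotient : ∀ p r n → coeff (quotient p r) n ≈ coeff p (suc n) + r * coeff (quotient p r) (suc n)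
  coeff-quotient []            r n       = sym (trans (+-identityˡ _) (zeroʳ r))
  coeff-quotient (a ∷ [])      r zero    = sym (trans (+-identityˡ _) (zeroʳ r))
  coeff-quotient (a ∷ b ∷ p)   r zero    = refl
  coeff-quotient (a ∷ p)       r (suc n) = coeff-quotient p r n

  quotient-degree : ∀ p r n → DegreeAtMost p (suc n) → DegreeAtMost (quotient p r) n
  quotient-degree []      r n d k       n<k = refl
  quotient-degree (a ∷ p) r n d zero    ()
  quotient-degree (a ∷ p) r n d (suc k) n<k = go p n k n<k d
    where
    -- the coefficients of the quotient are values of tails of p
    go : ∀ p n k → n ℕ.< suc k → DegreeAtMost (a ∷ p) (suc n) → coeff (quotient p r) k ≈ 0#
    go []      n k       n<k d = refl
    go (b ∷ p) n zero    (ℕ.s≤s ℕ.z≤n) d = eval-cong p [] r (λ j → d (suc (suc j)) (ℕ.s≤s (ℕ.s≤s ℕ.z≤n)))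
    go (b ∷ p) zero (suc k) n<k d = go p zero k (ℕ.s≤s ℕ.z≤n) λ
      { zero () ; (suc j) 1<j → d (suc (suc j)) (ℕ.≤-trans 1<j (ℕ.n≤1+n _)) }
    go (b ∷ p) (suc n) (suc k) n<k d = go p n k (ℕ.≤-pred n<k) λ
      { zero () ; (suc j) n<j → d (suc (suc j)) (ℕ.s≤s n<j) }

  -- The factor theorem.
  divide : ∀ p r → eval p r ≈ 0# → p ≈ₚ (X- r) *ₚ quotient p r
  divide []      r _   zero    = sym (trans (coeff-linear-zero r []) (zeroʳ _))
  divide (a ∷ p) r p≈0 zero    = begin
    a                                            ≈⟨ solve 3 (λ a r u → a := (a :+ r :* u) :- r :* u) refl a r (eval p r) ⟩
    a + r * eval p r - r * eval p r              ≈⟨ +-congʳ p≈0 ⟩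
    0# - r * eval p r                            ≈⟨ solve 2 (λ r u → :0 :- r :* u := :- r :* u) refl r (eval p r) ⟩
    - r * eval p r                               ≈⟨ coeff-linear-zero r (quotient (a ∷ p) r) ⟨
    coeff ((X- r) *ₚ quotient (a ∷ p) r) 0       ∎
  divide p       r _   (suc n) = begin
    coeff p (suc n)
      ≈⟨ solve 3 (λ c r u → c := c :+ r :* u :- r :* u) refl (coeff p (suc n)) r (coeff (quotient p r) (suc n)) ⟩
    coeff p (suc n) + r * coeff (quotient p r) (suc n) - r * coeff (quotient p r) (suc n)
      ≈⟨ +-congʳ (coeff-quotient p r n) ⟨
    coeff (quotient p r) n - r * coeff (quotient p r) (suc n)
      ≈⟨ coeff-linear-suc r (quotient p r) n ⟨
    coeff ((X- r) *ₚ quotient p r) (suc n) ∎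

  linear-· : ∀ z c p → (X- z) *ₚ (c ·ₚ p) ≈ₚ c ·ₚ ((X- z) *ₚ p)
  linear-· z c p zero = begin
    coeff ((X- z) *ₚ (c ·ₚ p)) 0      ≈⟨ coeff-linear-zero z (c ·ₚ p) ⟩
    - z * coeff (c ·ₚ p) 0            ≈⟨ *-congˡ (coeff-· c p 0) ⟩
    - z * (c * coeff p 0)             ≈⟨ solve 3 (λ z c u → :- z :* (c :* u) := c :* (:- z :* u)) refl z c (coeff p 0) ⟩
    c * (- z * coeff p 0)             ≈⟨ *-congˡ (coeff-linear-zero z p) ⟨
    c * coeff ((X- z) *ₚ p) 0         ≈⟨ coeff-· c ((X- z) *ₚ p) 0 ⟨
    coeff (c ·ₚ ((X- z) *ₚ p)) 0      ∎
  linear-· z c p (suc n) = begin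
    coeff ((X- z) *ₚ (c ·ₚ p)) (suc n)                     ≈⟨ coeff-linear-suc z (c ·ₚ p) n ⟩
    coeff (c ·ₚ p) n - z * coeff (c ·ₚ p) (suc n)          ≈⟨ +-cong (coeff-· c p n) (-‿cong (*-congˡ (coeff-· c p (suc n)))) ⟩
    c * coeff p n - z * (c * coeff p (suc n))              ≈⟨ solve 4 (λ z c u v → c :* u :- z :* (c :* v) := c :* (u :- z :* v)) refl
                                                                z c (coeff p n) (coeff p (suc n)) ⟩
    c * (coeff p n - z * coeff p (suc n))                  ≈⟨ *-congˡ (coeff-linear-suc z p n) ⟨
    c * coeff ((X- z) *ₚ p) (suc n)                        ≈⟨ coeff-· c ((X- z) *ₚ p) (suc n) ⟨
    coeff (c ·ₚ ((X- z) *ₚ p)) (suc n)                     ∎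

  Root : Poly → Carrier → Set
  Root p r = eval p r ≈ 0#

  -- A polynomial of degree at most n with n distinct roots is determined by
  -- them up to its coefficient at n. The induction removes one root at a time,
  -- and the others remain roots of the quotient.
  factor : ∀ p rs → DegreeAtMost p (length rs) → AllPairs _≉_ rs → All (Root p) rs →
           p ≈ₚ coeff p (length rs) ·ₚ monicWithZeros rs
  factor p [] d _ _ zero = trans (sym (*-identityʳ _)) (sym (coeff-· (coeff p 0) (1# ∷ []) 0))
  factor p [] d _ _ (suc n) = d (suc n) (ℕ.s≤s ℕ.z≤n)
  factor p (r ∷ rs) d (r≉rs ∷ distinct) (pr≈0 ∷ prs) n = begin
    coeff p n                                      ≈⟨ p≈ n ⟩
    coeff ((X- r) *ₚ q) n                          ≈⟨ linear-cong r q (l ·ₚ monicWithZeros rs) q≈ n ⟩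
    coeff ((X- r) *ₚ (l ·ₚ monicWithZeros rs)) n   ≈⟨ linear-· r l (monicWithZeros rs) n ⟩
    coeff (l ·ₚ monicWithZeros (r ∷ rs)) n         ≈⟨ coeff-· l (monicWithZeros (r ∷ rs)) n ⟩
    l * coeff (monicWithZeros (r ∷ rs)) n          ≈⟨ *-congʳ lead ⟩
    _ * coeff (monicWithZeros (r ∷ rs)) n          ≈⟨ coeff-· _ (monicWithZeros (r ∷ rs)) n ⟨
    coeff (_ ·ₚ monicWithZeros (r ∷ rs)) n         ∎
    where
    q : Poly
    q = quotient p r
    l : Carrier
    l = coeff q (length rs)
    p≈ : p ≈ₚ (X- r) *ₚ q
    p≈ = divide p r pr≈0
    dq : DegreeAtMost q (length rs)
    dq = quotient-degree p r (length rs) d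
    root-q : ∀ {z} → r ≉ z × Root p z → Root q z
    root-q {z} (r≉z , pz≈0) = *-cancelˡ
      (λ z-r≈0 → r≉z (trans (sym (+-identityˡ r)) (trans (+-congʳ (sym z-r≈0))
        (solve 2 (λ z r → z :- r :+ r := z) refl z r))))
      (trans (sym (eval-linear r q z)) (trans (sym (eval-cong p ((X- r) *ₚ q) z p≈)) (trans pz≈0 (sym (zeroʳ _)))))
    q≈ : q ≈ₚ coeff q (length rs) ·ₚ monicWithZeros rs
    q≈ = factor q rs dq distinct (All.map root-q (All.zip (r≉rs , prs)))
    -- Horner's rule for the top coefficient of q, beyond which q vanishes
    lead : coeff q (length rs) ≈ coeff p (suc (length rs))
    lead = trans (coeff-quotient p r (length rs))
      (trans (+-congˡ (trans (*-congˡ (dq _ (ℕ.n<1+n _))) (zeroʳ r))) (+-identityʳ _))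

-- The intermediate value theorem and alternating signs

module IntermediateValue (ℝ : CompleteOrderedField) where
  open CompleteOrderedField ℝ
  open Eulerian ℝ
  open OrderedField ℝ
  open PolynomialAlgebra ℝ

  -- The absolute value of v is at most K.
  Bounded : Carrier → Carrier → Set
  Bounded v K = v ≤ K × - v ≤ K

  ≤-resp : ∀ {x y z w} → x ≈ y → z ≈ w → x ≤ z → y ≤ w
  ≤-resp x≈y z≈w x≤z = ≤-trans (≈⇒≤ (sym x≈y)) (≤-trans x≤z (≈⇒≤ z≈w))

  bounded-resp : ∀ {v w K L} → v ≈ w → K ≈ L → Bounded v K → Bounded w L
  bounded-resp v≈w K≈L (v≤K , -v≤K) = ≤-resp v≈w K≈L v≤K , ≤-resp (-‿cong v≈w) K≈L -v≤K

  bounded-+ : ∀ {v w K L} → Bounded v K → Bounded w L → Bounded (v + w) (K + L)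
  bounded-+ {v} {w} {K} {L} (v≤K , -v≤K) (w≤L , -w≤L) =
    by-gap≤ (solve 4 (λ v w K L → (K :- v) :+ (L :- w) := (K :+ L) :- (v :+ w)) refl v w K L)
      (+-nonneg (gap≤ v≤K) (gap≤ w≤L)) ,
    by-gap≤ (solve 4 (λ v w K L → (K :- :- v) :+ (L :- :- w) := (K :+ L) :- :- (v :+ w)) refl v w K L)
      (+-nonneg (gap≤ -v≤K) (gap≤ -w≤L))

  bounded-scale : ∀ {x M v K} → 0# ≤ x → x ≤ M → 0# ≤ K → Bounded v K → Bounded (x * v) (M * K)
  bounded-scale {x} {M} {v} {K} 0≤x x≤M 0≤K (v≤K , -v≤K) =
    by-gap≤ (solve 4 (λ x M v K → (M :- x) :* K :+ x :* (K :- v) := M :* K :- x :* v) refl x M v K)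
      (+-nonneg (*-nonneg (gap≤ x≤M) 0≤K) (*-nonneg 0≤x (gap≤ v≤K))) ,
    by-gap≤ (solve 4 (λ x M v K → (M :- x) :* K :+ x :* (K :- :- v) := M :* K :- :- (x :* v)) refl x M v K)
      (+-nonneg (*-nonneg (gap≤ x≤M) 0≤K) (*-nonneg 0≤x (gap≤ -v≤K)))

  bound : ∀ v → ∃[ K ] (0# ≤ K × Bounded v K)
  bound v with compare v 0#
  ... | tri< v<0 _ _ = - v , <⇒≤ (neg⇒pos v<0) , <⇒≤ (<-trans v<0 (neg⇒pos v<0)) , ≤-refl
  ... | tri≈ _ v≈0 _ = 0# , ≤-refl , ≈⇒≤ v≈0 , ≈⇒≤ (trans (-‿cong v≈0) (solve 0 (:- :0 := :0) refl))
  ... | tri> _ _ 0<v = v , <⇒≤ 0<v , ≤-refl , <⇒≤ (by-gap (solve 1 (λ v → v :+ v := v :- :- v) refl v) (+-pos 0<v 0<v))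

  eval-bounded : ∀ p {M} → 0# ≤ M → ∃[ K ] (0# ≤ K × (∀ x → 0# ≤ x → x ≤ M → Bounded (eval p x) K))
  eval-bounded []      0≤M = 0# , ≤-refl , λ x _ _ → ≤-refl , ≈⇒≤ (solve 0 (:- :0 := :0) refl)
  eval-bounded (a ∷ p) 0≤M with bound a | eval-bounded p 0≤M
  ... | A , 0≤A , a-bd | K , 0≤K , p-bd =
    A + _ * K , +-nonneg 0≤A (*-nonneg 0≤M 0≤K) ,
    λ x 0≤x x≤M → bounded-+ a-bd (bounded-scale 0≤x x≤M 0≤K (p-bd x 0≤x x≤M))

  -- p has Lipschitz constant L on [0, M].
  LipschitzOn : Poly → Carrier → Carrier → Set
  LipschitzOn p M L = ∀ x y → 0# ≤ x → x ≤ y → y ≤ M → Bounded (eval p y - eval p x) (L * (y - x))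

  lipschitz : ∀ p {M} → 0# ≤ M → ∃[ L ] (0# ≤ L × LipschitzOn p M L)
  lipschitz []      0≤M = 0# , ≤-refl , λ x y _ _ _ →
    bounded-resp refl (sym (zeroˡ _)) (≈⇒≤ (-‿inverseʳ 0#) , ≈⇒≤ (solve 0 (:- (:0 :- :0) := :0) refl))
  lipschitz (a ∷ p) {M} 0≤M with eval-bounded p 0≤M | lipschitz p 0≤M
  ... | K , 0≤K , p-bd | L , 0≤L , p-lip =
    M * L + K , +-nonneg (*-nonneg 0≤M 0≤L) 0≤K , λ x y 0≤x x≤y y≤M →
    bounded-resp
      (solve 5 (λ a x y u v → y :* (v :- u) :+ (y :- x) :* u := (a :+ y :* v) :- (a :+ x :* u)) refl
        a x y (eval p x) (eval p y))
      (solve 5 (λ M L K x y → M :* (L :* (y :- x)) :+ (y :- x) :* K := (M :* L :+ K) :* (y :- x)) refl M L K x y)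
      (bounded-+
        (bounded-scale (≤-trans 0≤x x≤y) y≤M (*-nonneg 0≤L (gap≤ x≤y)) (p-lip x y 0≤x x≤y y≤M))
        (bounded-scale (gap≤ x≤y) ≤-refl 0≤K (p-bd x 0≤x (≤-trans x≤y y≤M))))

  opaque
    -- With e = A D / (A + L D), both D − e and A − L e are explicit quotients
    -- of nonnegative terms.
    small : ∀ {A D L} → 0# < A → 0# < D → 0# ≤ L → ∃[ e ] (0# < e × e ≤ D × L * e < A)
    small {A} {D} {L} 0<A 0<D 0≤L =
      A * D * i , *-pos (*-pos 0<A 0<D) 0<i ,
      by-gap≤
        (trans (solve 4 (λ A D L i → L :* D :* D :* i := D :* ((A :+ L :* D) :* i) :- A :* D :* i) refl A D L i)
          (+-congʳ (trans (*-congˡ inv) (*-identityʳ D))))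
        (*-nonneg (*-nonneg (*-nonneg 0≤L (<⇒≤ 0<D)) (<⇒≤ 0<D)) (<⇒≤ 0<i)) ,
      by-gap
        (trans (solve 4 (λ A D L i → A :* A :* i := A :* ((A :+ L :* D) :* i) :- L :* (A :* D :* i)) refl A D L i)
          (+-congʳ (trans (*-congˡ inv) (*-identityʳ A))))
        (*-pos (*-pos 0<A 0<A) 0<i)
      where
      0<s : 0# < A + L * D
      0<s = pos+nonneg 0<A (*-nonneg 0≤L (<⇒≤ 0<D))
      i : Carrier
      i = (A + L * D) ⁻¹
      0<i : 0# < i
      0<i = ⁻¹-pos 0<s
      inv : (A + L * D) * i ≈ 1#
      inv = ⁻¹-inverseʳ _ (pos⇒≉0 0<s)

  eval-congʳ : ∀ p {x y} → x ≈ y → eval p x ≈ eval p y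
  eval-congʳ []      x≈y = refl
  eval-congʳ (a ∷ p) x≈y = +-congˡ (*-cong x≈y (eval-congʳ p x≈y))

  opaque
    negative-to-the-right : ∀ p {M L s} → 0# ≤ L → LipschitzOn p M L → 0# ≤ s → s < M → eval p s < 0# →
                            ∃[ t ] (s < t × t ≤ M × eval p t ≤ 0#)
    negative-to-the-right p {M} {L} {s} 0≤L lip 0≤s s<M ps<0 with small (neg⇒pos ps<0) (gap s<M) 0≤L
    ... | e , 0<e , e≤ , Le< = s + e , s<t , t≤M , by-gap≤
          (split L s e (eval p s) (eval p (s + e)))
          (+-nonneg (gap≤ (proj₁ (lip s (s + e) 0≤s (<⇒≤ s<t) t≤M))) (gap≤ (<⇒≤ Le<)))
      where
      split : ∀ L s e ps pt → (L * ((s + e) - s) - (pt - ps)) + (- ps - L * e) ≈ 0# - pt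
      split = solve 5 (λ L s e ps pt →
        (L :* ((s :+ e) :- s) :- (pt :- ps)) :+ (:- ps :- L :* e) := :0 :- pt) refl
      s<t : s < s + e
      s<t = by-gap (solve 2 (λ s e → e := (s :+ e) :- s) refl s e) 0<e
      t≤M : s + e ≤ M
      t≤M = by-gap≤ (solve 3 (λ s e v → (v :- s) :- e := v :- (s :+ e)) refl s e M) (gap≤ e≤)

  opaque
    positive-to-the-left : ∀ p {M L s} → 0# ≤ L → LipschitzOn p M L → s ≤ M → 0# < eval p s →
                           ∃[ t ] (t < s × (∀ x → 0# ≤ x → t < x → x ≤ s → 0# < eval p x))
    positive-to-the-left p {M} {L} {s} 0≤L lip s≤M 0<ps with small 0<ps 0<1 0≤L
    ... | e , 0<e , _ , Le< = s - e , by-gap (solve 2 (λ s e → e := s :- (s :- e)) refl s e) 0<e ,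
      λ x 0≤x t<x x≤s → pos-resp
        (split L s e x (eval p s) (eval p x))
        (pos+nonneg (gap Le<) (+-nonneg (gap≤ (proj₁ (lip x s 0≤x x≤s s≤M)))
          (*-nonneg 0≤L (<⇒≤ (gap t<x)))))
      where
      split : ∀ L s e x ps px → (ps - L * e) + ((L * (s - x) - (ps - px)) + L * (x - (s - e))) ≈ px
      split = solve 6 (λ L s e x ps px →
        (ps :- L :* e) :+ ((L :* (s :- x) :- (ps :- px)) :+ L :* (x :- (s :- e))) := px) refl

  opaque
    -- The root is the supremum of the points of [u, v] at which p is at most 0.
    intermediate-value : ∀ p {u v} → 0# ≤ u → u < v → eval p u < 0# → 0# < eval p v →
                         ∃[ r ] (u < r × r < v × Root p r)
    intermediate-value p {u} {v} 0≤u u<v pu<0 0<pv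
      with lipschitz p (≤-trans 0≤u (<⇒≤ u<v))
         | supremum (λ x → u ≤ x × x ≤ v × eval p x ≤ 0#)
             (u , ≤-refl , <⇒≤ u<v , <⇒≤ pu<0) (v , λ _ (_ , x≤v , _) → x≤v)
    ... | L , 0≤L , lip | s , above , least = s , u<s , s<v , ps≈0
      where
      u≤s : u ≤ s
      u≤s = above u (≤-refl , <⇒≤ u<v , <⇒≤ pu<0)
      s≤v : s ≤ v
      s≤v = least v (λ _ (_ , x≤v , _) → x≤v)

      not-negative : eval p s < 0# → ⊥
      not-negative ps<0 with s≤v
      ... | inj₂ s≈v = <-irrefl (<-trans 0<pv (<-respˡ-≈ (eval-congʳ p s≈v) ps<0))
      ... | inj₁ s<v with negative-to-the-right p 0≤L lip (≤-trans 0≤u u≤s) s<v ps<0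
      ...   | t , s<t , t≤v , pt≤0 = <-irrefl (<-≤-trans s<t (above t (≤-trans u≤s (<⇒≤ s<t) , t≤v , pt≤0)))

      not-positive : 0# < eval p s → ⊥
      not-positive 0<ps with positive-to-the-left p 0≤L lip s≤v 0<ps
      ... | t , t<s , 0<p = <-irrefl (≤-<-trans (least t t-above) t<s)
        where
        t-above : ∀ x → u ≤ x × x ≤ v × eval p x ≤ 0# → x ≤ t
        t-above x x∈@(u≤x , x≤v , px≤0) with compare x t
        ... | tri< x<t _ _ = <⇒≤ x<t
        ... | tri≈ _ x≈t _ = ≈⇒≤ x≈t
        ... | tri> _ _ t<x =
          ⊥-elim (<-irrefl (<-≤-trans (0<p x (≤-trans 0≤u u≤x) t<x (above x x∈)) px≤0))

      ps≈0 : Root p s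
      ps≈0 with compare (eval p s) 0#
      ... | tri< ps<0 _ _ = ⊥-elim (not-negative ps<0)
      ... | tri≈ _ ps≈0 _ = ps≈0
      ... | tri> _ _ 0<ps = ⊥-elim (not-positive 0<ps)
      u<s : u < s
      u<s with u≤s
      ... | inj₁ u<s = u<s
      ... | inj₂ u≈s = ⊥-elim (irrefl (trans (eval-congʳ p u≈s) ps≈0) pu<0)
      s<v : s < v
      s<v with s≤v
      ... | inj₁ s<v = s<v
      ... | inj₂ s≈v = ⊥-elim (irrefl (sym (trans (sym (eval-congʳ p s≈v)) ps≈0)) 0<pv)

  opaque
    -- The intermediate value theorem, for a change of sign in either direction.
    sign-change : ∀ σ p {u v} → 0# ≤ u → u < v → 0# < - σ * eval p u → 0# < σ * eval p v →
                  ∃[ r ] (u < r × r < v × Root p r)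
    sign-change σ p {u} {v} 0≤u u<v pu pv with intermediate-value (σ ·ₚ p) 0≤u u<v
      (by-gap (trans (solve 2 (λ σ x → :- σ :* x := :0 :- σ :* x) refl σ (eval p u))
        (+-congˡ (-‿cong (sym (eval-· σ p u))))) pu)
      (pos-resp (sym (eval-· σ p v)) pv)
    ... | r , u<r , r<v , σpr≈0 = r , u<r , r<v ,
      *-cancelˡ (λ σ≈0 → pos⇒≉0 pv (trans (*-congʳ σ≈0) (zeroˡ _)))
        (trans (sym (eval-· σ p r)) (trans σpr≈0 (sym (zeroʳ σ))))

  opaque
    -- A polynomial with positive leading coefficient is bounded below by a
    -- positive constant near infinity.
    eventually-positive : ∀ p n → DegreeAtMost p n → 0# < coeff p n →
      ∃[ e ] ∃[ M ] (0# < e × 0# ≤ M × (∀ x → M ≤ x → e ≤ eval p x))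
    eventually-positive []      n       d 0<l = ⊥-elim (<-irrefl 0<l)
    eventually-positive (a ∷ p) zero    d 0<l = a , 0# , 0<l , ≤-refl , λ x _ →
      ≈⇒≤ (sym (trans (+-congˡ (trans (*-congˡ (eval-cong p [] x (λ n → d (suc n) (ℕ.s≤s ℕ.z≤n)))) (zeroʳ x)))
        (+-identityʳ a)))
    eventually-positive (a ∷ p) (suc n) d 0<l
      with eventually-positive p n (λ k n<k → d (suc k) (ℕ.s≤s n<k)) 0<l
    ... | e , M , 0<e , 0≤M , e≤p with bound (e - a)
    -- beyond K / e, where K bounds e − a, the term x e is at least e − a
    ...   | K , 0≤K , e-a≤K , _ = e , M + K * e ⁻¹ , 0<e , +-nonneg 0≤M 0≤Ki , lower
      where
      0≤Ki : 0# ≤ K * e ⁻¹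
      0≤Ki = *-nonneg 0≤K (<⇒≤ (⁻¹-pos 0<e))
      lower : ∀ x → M + K * e ⁻¹ ≤ x → e ≤ a + x * eval p x
      lower x M'≤x =
        ≤-trans (by-gap≤ (solve 3 (λ e a K → K :- (e :- a) := (a :+ K) :- e) refl e a K) (gap≤ e-a≤K))
        (≤-trans (≈⇒≤ (+-congˡ (sym K/e*e≈K)))
        (≤-trans (by-gap≤ (solve 4 (λ a e x k → (x :- k) :* e := (a :+ x :* e) :- (a :+ k :* e)) refl a e x (K * e ⁻¹))
                   (*-nonneg (gap≤ K/e≤x) (<⇒≤ 0<e)))
                 (by-gap≤ (solve 4 (λ a e x u → x :* (u :- e) := (a :+ x :* u) :- (a :+ x :* e)) refl a e x (eval p x))
                   (*-nonneg (≤-trans 0≤M M≤x) (gap≤ (e≤p x M≤x))))))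
        where
        K/e*e≈K : K * e ⁻¹ * e ≈ K
        K/e*e≈K = trans (*-assoc K _ e)
          (trans (*-congˡ (trans (*-comm _ e) (⁻¹-inverseʳ e (pos⇒≉0 0<e)))) (*-identityʳ K))
        M≤x : M ≤ x
        M≤x = ≤-trans (by-gap≤ (solve 2 (λ M y → y := (M :+ y) :- M) refl M (K * e ⁻¹)) 0≤Ki) M'≤x
        K/e≤x : K * e ⁻¹ ≤ x
        K/e≤x = ≤-trans (by-gap≤ (solve 2 (λ M y → M := (M :+ y) :- y) refl M (K * e ⁻¹)) 0≤M) M'≤x

  opaque
    sign-at-infinity : ∀ σ p n b → 0# ≤ b → DegreeAtMost p n → 0# < σ * coeff p n →
                       ∃[ M ] (b < M × 0# < σ * eval p M)
    sign-at-infinity σ p n b 0≤b d 0<l with eventually-positive (σ ·ₚ p) n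
      (λ k n<k → trans (coeff-· σ p k) (trans (*-congˡ (d k n<k)) (zeroʳ σ))) (pos-resp (sym (coeff-· σ p n)) 0<l)
    ... | e , M , 0<e , 0≤M , e≤ = M + (b + 1#) ,
      by-gap (solve 2 (λ M b → :1 :+ M := (M :+ (b :+ :1)) :- b) refl M b) (pos+nonneg 0<1 0≤M) ,
      pos-resp (eval-· σ p _) (<-≤-trans 0<e (e≤ _
        (by-gap≤ (solve 2 (λ M b → b :+ :1 := (M :+ (b :+ :1)) :- M) refl M b) (+-nonneg 0≤b (<⇒≤ 0<1)))))

  -- Strictly descending lists.
  Descending : List Carrier → Set
  Descending = AllPairs (λ x y → y < x)

  -- The values of p at the listed points have the signs of σ, −σ, σ, and so on.
  Alternates : Carrier → Poly → List Carrier → Set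
  Alternates σ p []       = ⊤
  Alternates σ p (x ∷ xs) = 0# < σ * eval p x × Alternates (- σ) p xs

  opaque
    -- Each change of sign contributes a root between neighbouring points.
    alternation-roots : ∀ {b} σ p x xs → 0# ≤ b → Descending (x ∷ xs) → All (b ≤_) xs → Alternates σ p (x ∷ xs) →
      ∃[ rs ] (length rs ≡ length xs × Descending rs × All (λ r → b < r) rs × All (_< x) rs × All (Root p) rs)
    alternation-roots σ p x [] _ _ _ _ = [] , ≡.refl , [] , [] , [] , []
    alternation-roots σ p x (y ∷ ys) 0≤b ((y<x ∷ _) ∷ desc) (b≤y ∷ b≤ys) (px , py , alt)
      with sign-change σ p (≤-trans 0≤b b≤y) y<x py px | alternation-roots (- σ) p y ys 0≤b desc b≤ys (py , alt)
    ... | r , y<r , r<x , pr | rs , len , rs-desc , b<rs , rs<y , prs =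
      r ∷ rs , ≡.cong suc len , All.map (λ z<y → <-trans z<y y<r) rs<y ∷ rs-desc , ≤-<-trans b≤y y<r ∷ b<rs ,
      r<x ∷ All.map (λ z<y → <-trans z<y (<-trans y<r r<x)) rs<y , pr ∷ prs

-- The recurrence for Eulerian polynomials and the location of zeros

module EulerianZeros (ℝ : CompleteOrderedField) where
  open CompleteOrderedField ℝ
  open Eulerian ℝ
  open OrderedField ℝ
  open PolynomialAlgebra ℝ
  open IntermediateValue ℝ
  open import Relation.Binary.Reasoning.Setoid setoid

  -- The operator p ↦ (α (1 − x) + s x) p + x (1 − x) p', by recursion on the
  -- coefficients: it maps w + x p to α w + x ((s − α) w + r), where r is the
  -- image of p for the parameters s and α + 1.
  step : Carrier → Carrier → Poly → Poly
  step s α []      = []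
  step s α (w ∷ p) = α * w ∷ (((s - α) * w ∷ []) +ₚ step s (α + 1#) p)

  -- The Eulerian polynomial of the unnormalised product of the X + α over the
  -- list. The first parameter of each step is a plus the number of factors
  -- that were multiplied in before.
  euler : Carrier → List Carrier → Poly
  euler a []       = 1# ∷ []
  euler a (α ∷ αs) = step (fromℕ (length αs) + a) α (euler a αs)

  coeff-step-zero : ∀ s α p → coeff (step s α p) 0 ≈ α * coeff p 0
  coeff-step-zero s α []      = sym (zeroʳ α)
  coeff-step-zero s α (w ∷ p) = refl

  coeff-step-suc : ∀ s α p n → coeff (step s α p) (suc n) ≈
                   (α + fromℕ (suc n)) * coeff p (suc n) + (s - α - fromℕ n) * coeff p n
  coeff-step-suc s α []      n       = solve 2 (λ u v → :0 := u :* :0 :+ v :* :0) refl _ _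
  coeff-step-suc s α (w ∷ p) zero    = begin
    coeff (((s - α) * w ∷ []) +ₚ step s (α + 1#) p) 0
      ≈⟨ coeff-+ ((s - α) * w ∷ []) (step s (α + 1#) p) 0 ⟩
    (s - α) * w + coeff (step s (α + 1#) p) 0
      ≈⟨ +-congˡ (coeff-step-zero s (α + 1#) p) ⟩
    (s - α) * w + (α + 1#) * coeff p 0
      ≈⟨ solve 4 (λ s α w u → (s :- α) :* w :+ (α :+ :1) :* u := (α :+ (:1 :+ :0)) :* u :+ (s :- α :- :0) :* w) refl
           s α w (coeff p 0) ⟩
    (α + fromℕ 1) * coeff p 0 + (s - α - fromℕ 0) * w ∎
  coeff-step-suc s α (w ∷ p) (suc n) = begin
    coeff (((s - α) * w ∷ []) +ₚ step s (α + 1#) p) (suc n)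
      ≈⟨ coeff-+ ((s - α) * w ∷ []) (step s (α + 1#) p) (suc n) ⟩
    0# + coeff (step s (α + 1#) p) (suc n)
      ≈⟨ +-congˡ (coeff-step-suc s (α + 1#) p n) ⟩
    0# + ((α + 1# + (1# + fromℕ n)) * coeff p (suc n) + (s - (α + 1#) - fromℕ n) * coeff p n)
      ≈⟨ rearrange s α (fromℕ n) (coeff p (suc n)) (coeff p n) ⟩
    (α + fromℕ (suc (suc n))) * coeff p (suc n) + (s - α - fromℕ (suc n)) * coeff p n ∎
    where
    rearrange : ∀ s α k u v → 0# + ((α + 1# + (1# + k)) * u + (s - (α + 1#) - k) * v)
                              ≈ (α + (1# + (1# + k))) * u + (s - α - (1# + k)) * v
    rearrange = solve 5 (λ s α k u v → :0 :+ ((α :+ :1 :+ (:1 :+ k)) :* u :+ (s :- (α :+ :1) :- k) :* v)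
                              := (α :+ (:1 :+ (:1 :+ k))) :* u :+ (s :- α :- (:1 :+ k)) :* v) refl

  eval-step : ∀ s α p x →
    eval (step s α p) x ≈ (α * (1# - x) + s * x) * eval p x + x * (1# - x) * deriv p x
  eval-step s α []      x = solve 2 (λ u v → :0 := u :* :0 :+ v :* :0) refl _ _
  eval-step s α (w ∷ p) x = begin
    α * w + x * eval (((s - α) * w ∷ []) +ₚ step s (α + 1#) p) x
      ≈⟨ +-congˡ (*-congˡ (eval-+ ((s - α) * w ∷ []) (step s (α + 1#) p) x)) ⟩
    α * w + x * (((s - α) * w + x * 0#) + eval (step s (α + 1#) p) x)
      ≈⟨ +-congˡ (*-congˡ (+-congˡ (eval-step s (α + 1#) p x))) ⟩
    α * w + x * (((s - α) * w + x * 0#) + (((α + 1#) * (1# - x) + s * x) * eval p x + x * (1# - x) * deriv p x))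
      ≈⟨ rearrange s α w x (eval p x) (deriv p x) ⟩
    (α * (1# - x) + s * x) * (w + x * eval p x) + x * (1# - x) * (eval p x + x * deriv p x) ∎
    where
    rearrange : ∀ s α w x u v →
      α * w + x * (((s - α) * w + x * 0#) + (((α + 1#) * (1# - x) + s * x) * u + x * (1# - x) * v))
      ≈ (α * (1# - x) + s * x) * (w + x * u) + x * (1# - x) * (u + x * v)
    rearrange = solve 6 (λ s α w x u v →
      α :* w :+ x :* (((s :- α) :* w :+ x :* :0) :+ (((α :+ :1) :* (:1 :- x) :+ s :* x) :* u :+ x :* (:1 :- x) :* v))
      := (α :* (:1 :- x) :+ s :* x) :* (w :+ x :* u) :+ x :* (:1 :- x) :* (u :+ x :* v)) refl

  eval-step-0 : ∀ s α p → eval (step s α p) 0# ≈ α * eval p 0#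
  eval-step-0 s α p = trans (eval-step s α p 0#)
    (solve 4 (λ s α u v → (α :* (:1 :- :0) :+ s :* :0) :* u :+ :0 :* (:1 :- :0) :* v := α :* u) refl
      s α (eval p 0#) (deriv p 0#))

  eval-step-1 : ∀ s α p → eval (step s α p) 1# ≈ s * eval p 1#
  eval-step-1 s α p = trans (eval-step s α p 1#)
    (solve 4 (λ s α u v → (α :* (:1 :- :1) :+ s :* :1) :* u :+ :1 :* (:1 :- :1) :* v := s :* u) refl
      s α (eval p 1#) (deriv p 1#))

  eval-step-root : ∀ s α p z → Root p z → eval (step s α p) z ≈ z * (1# - z) * deriv p z
  eval-step-root s α p z pz≈0 = trans (eval-step s α p z)
    (trans (+-congʳ (trans (*-congˡ pz≈0) (zeroʳ _))) (+-identityˡ _))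

  step-degree : ∀ s α p n → DegreeAtMost p n → DegreeAtMost (step s α p) (suc n)
  step-degree s α p n d (suc k) (ℕ.s≤s n<k) = trans (coeff-step-suc s α p k)
    (trans (+-cong (trans (*-congˡ (d (suc k) (ℕ.m<n⇒m<1+n n<k))) (zeroʳ _)) (trans (*-congˡ (d k n<k)) (zeroʳ _)))
      (+-identityˡ 0#))

  step-lead : ∀ a α p n → DegreeAtMost p n → coeff (step (fromℕ n + a) α p) (suc n) ≈ (a - α) * coeff p n
  step-lead a α p n d = trans (coeff-step-suc (fromℕ n + a) α p n)
    (trans (+-congʳ (trans (*-congˡ (d (suc n) (ℕ.n<1+n n))) (zeroʳ _)))
      (solve 4 (λ a α k u → :0 :+ (k :+ a :- α :- k) :* u := (a :- α) :* u) refl a α (fromℕ n) (coeff p n)))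

  euler-degree : ∀ a αs → DegreeAtMost (euler a αs) (length αs)
  euler-degree a []       (suc n) _ = refl
  euler-degree a (α ∷ αs)           = step-degree _ α (euler a αs) (length αs) (euler-degree a αs)

  monic-positive : ∀ zs x → All (_< x) zs → 0# < eval (monicWithZeros zs) x
  monic-positive []       x []           = pos-resp (sym (trans (+-congˡ (zeroʳ x)) (+-identityʳ 1#))) 0<1
  monic-positive (z ∷ zs) x (z<x ∷ zs<x) =
    pos-resp (sym (eval-linear z (monicWithZeros zs) x)) (*-pos (gap z<x) (monic-positive zs x zs<x))

  -- W stands for an Eulerian polynomial and V for the next one. At a zero
  -- z > 1 of W the value z (1 − z) W'(z) of V has the sign opposite to that of
  -- W'(z), so that V alternates along the zeros. The recursion removes them
  -- from the largest on: W is A times the product of X − z over the zeros not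
  -- yet visited, all of them below b, and A, with derivative A', has the sign of
  -- σ below b. The points appended as ends are those where the sign of V is
  -- obtained from the value of W at 1.
  alternates-at-zeros : ∀ W V ends →
    (∀ z → Root W z → eval V z ≈ z * (1# - z) * deriv W z) →
    (∀ τ → 0# < τ * eval W 1# → Alternates (- τ) V ends) →
    ∀ σ (A A' : Carrier → Carrier) b zs → 1# < b → Descending zs → All (1# <_) zs → All (_< b) zs →
    (∀ x → x < b → 0# < σ * A x) →
    (∀ x → eval W x ≈ A x * eval (monicWithZeros zs) x) →
    (∀ x → deriv W x ≈ A' x * eval (monicWithZeros zs) x + A x * deriv (monicWithZeros zs) x) →
    Alternates (- σ) V (zs ++ ends)
  alternates-at-zeros W V ends V-root V-end σ A A' b [] 1<b _ _ _ A-sign W≈ W'≈ =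
    V-end σ (pos-resp (*-congˡ (sym (trans (W≈ 1#)
      (solve 1 (λ u → u :* (:1 :+ :1 :* :0) := u) refl (A 1#))))) (A-sign 1# 1<b))
  alternates-at-zeros W V ends V-root V-end σ A A' b (z ∷ zs) 1<b (zs<z ∷ desc) (1<z ∷ 1<zs) (z<b ∷ _) A-sign W≈ W'≈ =
    pos-resp (sym V≈) (*-pos (*-pos (*-pos (<-trans 0<1 1<z) (gap 1<z)) (A-sign z z<b)) (monic-positive zs z zs<z)) ,
    alternates-at-zeros W V ends V-root V-end (- σ) A₁ A₁' z zs 1<z desc 1<zs zs<z A₁-sign W≈₁ W'≈₁
    where
    P : Poly
    P = monicWithZeros zs
    A₁ A₁' : Carrier → Carrier
    A₁ x = A x * (x - z)
    A₁' x = A' x * (x - z) + A x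
    A₁-sign : ∀ x → x < z → 0# < - σ * A₁ x
    A₁-sign x x<z = pos-resp (solve 4 (λ σ A x z → σ :* A :* (z :- x) := :- σ :* (A :* (x :- z))) refl σ (A x) x z)
      (*-pos (A-sign x (<-trans x<z z<b)) (gap x<z))
    W≈₁ : ∀ x → eval W x ≈ A₁ x * eval P x
    W≈₁ x = trans (W≈ x) (trans (*-congˡ (eval-linear z P x)) (sym (*-assoc _ _ _)))
    W'≈₁ : ∀ x → deriv W x ≈ A₁' x * eval P x + A₁ x * deriv P x
    W'≈₁ x = trans (W'≈ x) (trans (+-cong (*-congˡ (eval-linear z P x)) (*-congˡ (deriv-linear z P x)))
      (solve 5 (λ A A' d u v → A' :* (d :* u) :+ A :* (u :+ d :* v) := (A' :* d :+ A) :* u :+ A :* d :* v) refl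
        (A x) (A' x) (x - z) (eval P x) (deriv P x)))
    V≈ : - σ * eval V z ≈ z * (z - 1#) * (σ * A z) * eval P z
    V≈ = begin
      - σ * eval V z
        ≈⟨ *-congˡ (V-root z (trans (W≈₁ z) (solve 3 (λ A z u → A :* (z :- z) :* u := :0) refl (A z) z (eval P z)))) ⟩
      - σ * (z * (1# - z) * deriv W z)
        ≈⟨ *-congˡ (*-congˡ (W'≈₁ z)) ⟩
      - σ * (z * (1# - z) * ((A' z * (z - z) + A z) * eval P z + A z * (z - z) * deriv P z))
        ≈⟨ rearrange σ z (A z) (A' z) (eval P z) (deriv P z) ⟩
      z * (z - 1#) * (σ * A z) * eval P z ∎
      where
      rearrange : ∀ σ z A A' u v → - σ * (z * (1# - z) * ((A' * (z - z) + A) * u + A * (z - z) * v))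
                                   ≈ z * (z - 1#) * (σ * A) * u
      rearrange = solve 6 (λ σ z A A' u v →
        :- σ :* (z :* (:1 :- z) :* ((A' :* (z :- z) :+ A) :* u :+ A :* (z :- z) :* v))
        := z :* (z :- :1) :* (σ :* A) :* u) refl

  descending⇒distinct : ∀ {zs} → Descending zs → AllPairs _≉_ zs
  descending⇒distinct = AllPairs.map (λ y<x x≈y → irrefl (sym x≈y) y<x)

  opaque
    upper-bound : ∀ zs → Descending zs → All (1# <_) zs → ∃[ b ] (1# < b × All (_< b) zs)
    upper-bound []       _             _          =
      1# + 1# , by-gap (solve 0 (:1 := (:1 :+ :1) :- :1) refl) 0<1 , []
    upper-bound (z ∷ zs) (zs<z ∷ desc) (1<z ∷ _) =
      z + 1# , <-trans 1<z z<z+1 , z<z+1 ∷ All.map (λ y<z → <-trans y<z z<z+1) zs<z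
      where
      z<z+1 : z < z + 1#
      z<z+1 = by-gap (solve 1 (λ z → :1 := (z :+ :1) :- z) refl z) 0<1

  factors : ∀ V rs → DegreeAtMost V (length rs) → AllPairs _≉_ rs → All (Root V) rs → eval V 0# ≉ 0# →
            FactorsWithZeros V rs
  factors V rs deg distinct Vrs V0≉0 = coeff V (length rs) , c≉0 , V≈
    where
    V≈ : V ≈ₚ coeff V (length rs) ·ₚ monicWithZeros rs
    V≈ = factor V rs deg distinct Vrs
    c≉0 : coeff V (length rs) ≉ 0#
    c≉0 c≈0 = V0≉0 (trans (eval-cong V (_ ·ₚ monicWithZeros rs) 0# V≈)
      (trans (eval-· _ (monicWithZeros rs) 0#) (trans (*-congʳ c≈0) (zeroˡ _))))

  opaque
    -- One step of the recurrence: V has a zero in each gap of the sequence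
    -- formed by a large M, the zeros of W, and ends. At M the sign of V is that
    -- of its leading coefficient, which is a − α > 0 times the one of W. This
    -- coefficient c of W also serves as the sign σ at the start.
    interlace : ∀ a α W zs ends → DegreeAtMost W (length zs) →
      Descending zs → All (1# <_) zs → All (Root W) zs → eval W 0# ≉ 0# → α < a →
      Descending ends → All (1# ≈_) ends →
      (∀ τ → 0# < τ * eval W 1# → Alternates (- τ) (step (fromℕ (length zs) + a) α W) ends) →
      ∃[ rs ] (length rs ≡ length zs ℕ.+ length ends × Descending rs × All (1# <_) rs ×
               All (Root (step (fromℕ (length zs) + a) α W)) rs)
    interlace a α W zs ends deg desc 1<zs Wzs W0≉0 α<a desc-ends 1≈ends V-end =
      let
        V = step (fromℕ (length zs) + a) α W
        P = monicWithZeros zs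
        c = coeff W (length zs)
        (b , 1<b , zs<b) = upper-bound zs desc 1<zs
        (_ , c≉0 , W≈) = factors W zs deg (descending⇒distinct desc) Wzs W0≉0
        lead = trans (*-congˡ (step-lead a α W _ deg))
          (solve 3 (λ a α c → c :* ((a :- α) :* c) := (a :- α) :* (c :* c)) refl a α c)
        (M , b<M , VM) = sign-at-infinity c V (suc (length zs)) b (<⇒≤ (<-trans 0<1 1<b))
          (step-degree _ α W _ deg) (pos-resp (sym lead) (*-pos (gap α<a) (square-pos c≉0)))
        W-value = λ x → trans (eval-cong W (c ·ₚ P) x W≈) (eval-· c P x)
        W-deriv = λ x → trans (deriv-cong W (c ·ₚ P) x W≈)
          (trans (deriv-· c P x) (trans (sym (+-identityˡ _)) (+-congʳ (sym (zeroˡ (eval P x))))))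
        alternates = alternates-at-zeros W V ends (eval-step-root _ α W) V-end c (λ _ → c) (λ _ → 0#) b zs
          1<b desc 1<zs zs<b (λ _ _ → square-pos c≉0) W-value W-deriv
        zs>ends = All.map (λ 1<z → All.map (λ 1≈e → <-respˡ-≈ 1≈e 1<z) 1≈ends) 1<zs
        M>ends = All.map (λ 1≈e → <-respˡ-≈ 1≈e (<-trans 1<b b<M)) 1≈ends
        (rs , len , rs-desc , 1<rs , _ , Vrs) = alternation-roots c V M (zs ++ ends) (<⇒≤ 0<1)
          (All.++⁺ (All.map (λ z<b → <-trans z<b b<M) zs<b) M>ends ∷ AllPairs.++⁺ desc desc-ends zs>ends)
          (All.++⁺ (All.map <⇒≤ 1<zs) (All.map ≈⇒≤ 1≈ends)) (VM , alternates)
      in rs , ≡.trans len (length-++ zs) , rs-desc , 1<rs , Vrs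

  -- W has k distinct zeros above 1, and its values at 0 and 1 have the same
  -- sign. The zeros are simple when W has degree k.
  record DistinctZerosAbove1 (W : Poly) (k : ℕ) : Set where
    field
      zeros      : List Carrier
      number     : length zeros ≡ k
      descending : Descending zeros
      above-1    : All (1# <_) zeros
      are-zeros  : All (Root W) zeros
      same-sign  : 0# < eval W 0# * eval W 1#

  same-sign⇒≉0 : ∀ {x y} → 0# < x * y → x ≉ 0#
  same-sign⇒≉0 0<xy x≈0 = pos⇒≉0 0<xy (trans (*-congʳ x≈0) (zeroˡ _))

  fromℕ-nonneg : ∀ n → 0# ≤ fromℕ n
  fromℕ-nonneg zero    = ≤-refl
  fromℕ-nonneg (suc n) = +-nonneg (<⇒≤ 0<1) (fromℕ-nonneg n)

  lower-index : ∀ n a → fromℕ (suc n) + a < 1# → fromℕ n + a < 0#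
  lower-index n a <1 = by-gap (solve 2 (λ k a → :1 :- ((:1 :+ k) :+ a) := :0 :- (k :+ a)) refl (fromℕ n) a) (gap <1)

  opaque
    -- For s < 0 the sign of V at 1 is opposite to that of W, so that 1 closes
    -- the alternating sequence and the number of zeros above 1 grows by one.
    zeros-step : ∀ a α W k → a < 0# → α < a → fromℕ k + a < 0# → DegreeAtMost W k →
                 DistinctZerosAbove1 W k → DistinctZerosAbove1 (step (fromℕ k + a) α W) (suc k)
    zeros-step a α W _ a<0 α<a s<0 deg
      record { zeros = zs ; number = ≡.refl ; descending = desc ; above-1 = 1<zs ; are-zeros = Wzs ; same-sign = W01 } =
      let (rs , len , rs-desc , 1<rs , Vrs) =
            interlace a α W zs (1# ∷ []) deg desc 1<zs Wzs (same-sign⇒≉0 W01) α<a ([] ∷ []) (refl ∷ [])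
              (λ τ 0<τW1 → V-sign τ 0<τW1 , tt)
      in record
        { zeros = rs ; number = ≡.trans len (ℕ.+-comm _ 1) ; descending = rs-desc ; above-1 = 1<rs ; are-zeros = Vrs
        ; same-sign = pos-resp
            (trans (solve 4 (λ s α u v → α :* s :* (u :* v) := (α :* u) :* (s :* v)) refl s α (eval W 0#) (eval W 1#))
              (*-cong (sym (eval-step-0 s α W)) (sym (eval-step-1 s α W))))
            (*-pos (neg*neg (<-trans α<a a<0) s<0) W01) }
      where
      s : Carrier
      s = fromℕ (length zs) + a
      V-sign : ∀ τ → 0# < τ * eval W 1# → 0# < - τ * eval (step s α W) 1#
      V-sign τ 0<τW1 = pos-resp
        (trans (solve 3 (λ s τ u → :- s :* (τ :* u) := :- τ :* (s :* u)) refl s τ (eval W 1#))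
          (*-congˡ (sym (eval-step-1 s α W))))
        (*-pos (neg⇒pos s<0) 0<τW1)

  euler-zeros : ∀ a αs → a < 0# → All (_< a) αs → fromℕ (length αs) + a < 1# →
                DistinctZerosAbove1 (euler a αs) (length αs)
  euler-zeros a [] a<0 [] _ = record
    { zeros = [] ; number = ≡.refl ; descending = [] ; above-1 = [] ; are-zeros = []
    ; same-sign = pos-resp (solve 0 (:1 := (:1 :+ :0 :* :0) :* (:1 :+ :1 :* :0)) refl) 0<1 }
  euler-zeros a (α ∷ αs) a<0 (α<a ∷ αs<a) s<1 =
    zeros-step a α (euler a αs) (length αs) a<0 α<a s<0 (euler-degree a αs)
      (euler-zeros a αs a<0 αs<a (<-trans s<0 0<1))
    where
    s<0 : fromℕ (length αs) + a < 0#
    s<0 = lower-index (length αs) a s<1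

  opaque
    -- For s > 0 the alternating sequence ends at the least zero of W, but V changes
    -- sign between 0 and 1 because V(0) V(1) = α s W(0) W(1) is negative.
    zeros-last-step : ∀ a α W k → a < 0# → α < a → 0# < fromℕ k + a → DegreeAtMost W k → DistinctZerosAbove1 W k →
      let V = step (fromℕ k + a) α W in
      ∃[ r ] ∃[ rs ] (0# < r × r < 1# × All (1# <_) rs × length rs ≡ k × AllPairs _≉_ rs ×
                      All (Root V) (r ∷ rs) × eval V 0# ≉ 0#)
    zeros-last-step a α W _ a<0 α<a 0<s deg
      record { zeros = zs ; number = ≡.refl ; descending = desc ; above-1 = 1<zs ; are-zeros = Wzs ; same-sign = W01 } =
      let (rs , len , rs-desc , 1<rs , Vrs) =
            interlace a α W zs [] deg desc 1<zs Wzs (same-sign⇒≉0 W01) α<a [] [] (λ _ _ → tt)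
          (r , 0<r , r<1 , Vr) = sign-change (eval V 1#) V ≤-refl 0<1 V01 V11
      in r , rs , 0<r , r<1 , 1<rs , ≡.trans len (ℕ.+-identityʳ _) , descending⇒distinct rs-desc , Vr ∷ Vrs , V0≉0
      where
      s : Carrier
      s = fromℕ (length zs) + a
      V : Poly
      V = step s α W
      V01 : 0# < - eval V 1# * eval V 0#
      V01 = pos-resp
        (trans (solve 4 (λ s α u v → :- α :* s :* (u :* v) := :- (s :* v) :* (α :* u)) refl s α (eval W 0#) (eval W 1#))
          (*-cong (-‿cong (sym (eval-step-1 s α W))) (sym (eval-step-0 s α W))))
        (*-pos (*-pos (neg⇒pos (<-trans α<a a<0)) 0<s) W01)
      V11 : 0# < eval V 1# * eval V 1#
      V11 = square-pos (λ V1≈0 → same-sign⇒≉0 V01 (trans (-‿cong V1≈0) (solve 0 (:- :0 := :0) refl)))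
      V0≉0 : eval V 0# ≉ 0#
      V0≉0 V0≈0 = pos⇒≉0 V01 (trans (*-congˡ V0≈0) (zeroʳ _))

-- Power series and the identification of the Eulerian polynomial

module Series (ℝ : CompleteOrderedField) where
  open CompleteOrderedField ℝ
  open Eulerian ℝ
  open OrderedField ℝ
  open PolynomialAlgebra ℝ
  open EulerianZeros ℝ
  open import Algebra.Properties.Semiring.Mult semiring using (×1-homo-*)
  open import Relation.Binary.Reasoning.Setoid setoid

  ⊛-congˡ : ∀ (f g g' : PowerSeries) → (∀ n → g n ≈ g' n) → ∀ n → (f ⊛ g) n ≈ (f ⊛ g') n
  ⊛-congˡ f g g' g≈ zero    = +-congʳ (*-congˡ (g≈ 0))
  ⊛-congˡ f g g' g≈ (suc n) = +-cong (*-congˡ (g≈ (suc n))) (⊛-congˡ (λ k → f (suc k)) g g' g≈ n)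

  ⊛-congʳ : ∀ (f f' g : PowerSeries) → (∀ n → f n ≈ f' n) → ∀ n → (f ⊛ g) n ≈ (f' ⊛ g) n
  ⊛-congʳ f f' g f≈ zero    = +-congʳ (*-congʳ (f≈ 0))
  ⊛-congʳ f f' g f≈ (suc n) =
    +-cong (*-congʳ (f≈ 0)) (⊛-congʳ (λ k → f (suc k)) (λ k → f' (suc k)) g (λ k → f≈ (suc k)) n)

  ⊛-zeroˡ : ∀ (g : PowerSeries) n → ((λ _ → 0#) ⊛ g) n ≈ 0#
  ⊛-zeroˡ g zero    = trans (+-identityʳ _) (zeroˡ _)
  ⊛-zeroˡ g (suc n) = trans (+-cong (zeroˡ _) (⊛-zeroˡ g n)) (+-identityˡ 0#)

  ⊛-distribʳ : ∀ (f g h : PowerSeries) n → ((λ k → f k + g k) ⊛ h) n ≈ (f ⊛ h) n + (g ⊛ h) n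
  ⊛-distribʳ f g h zero    = solve 3 (λ f g h → (f :+ g) :* h :+ :0 := (f :* h :+ :0) :+ (g :* h :+ :0)) refl _ _ _
  ⊛-distribʳ f g h (suc n) = trans (+-congˡ (⊛-distribʳ (λ k → f (suc k)) (λ k → g (suc k)) h n))
    (solve 5 (λ f g h u v → (f :+ g) :* h :+ (u :+ v) := (f :* h :+ u) :+ (g :* h :+ v)) refl _ _ _ _ _)

  ⊛-scale : ∀ c (f g : PowerSeries) n → ((λ k → c * f k) ⊛ g) n ≈ c * (f ⊛ g) n
  ⊛-scale c f g zero    = solve 3 (λ c f g → c :* f :* g :+ :0 := c :* (f :* g :+ :0)) refl _ _ _
  ⊛-scale c f g (suc n) = trans (+-congˡ (⊛-scale c (λ k → f (suc k)) g n))
    (solve 4 (λ c f g u → c :* f :* g :+ c :* u := c :* (f :* g :+ u)) refl _ _ _ _)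

  -- Power series with constant term 1 can be cancelled.
  ⊛-cancelʳ : ∀ {g : PowerSeries} → g 0 ≈ 1# → ∀ (f f' : PowerSeries) → (∀ n → (f ⊛ g) n ≈ (f' ⊛ g) n) → ∀ n → f n ≈ f' n
  ⊛-cancelʳ {g} g0≈1 f f' e = go
    where
    head : f 0 ≈ f' 0
    head = trans (sym (unit (f 0))) (trans (e 0) (unit (f' 0)))
      where
      unit : ∀ u → u * g 0 + 0# ≈ u
      unit u = trans (+-identityʳ _) (trans (*-congˡ g0≈1) (*-identityʳ u))
    tail : ∀ n → ((λ k → f (suc k)) ⊛ g) n ≈ ((λ k → f' (suc k)) ⊛ g) n
    tail n = trans (sym (drop (f 0 * g (suc n)) _))
      (trans (+-congˡ (trans (e (suc n)) (+-congʳ (*-congʳ (sym head))))) (drop (f 0 * g (suc n)) _))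
      where
      drop : ∀ x y → - x + (x + y) ≈ y
      drop = solve 2 (λ x y → :- x :+ (x :+ y) := y) refl
    go : ∀ n → f n ≈ f' n
    go zero    = head
    go (suc n) = ⊛-cancelʳ g0≈1 (λ k → f (suc k)) (λ k → f' (suc k)) tail n

  -- The series of (1 − x)⁻ˢ.
  binomial : Carrier → PowerSeries
  binomial s n = pochhammer s n / fromℕ (n !)

  pochhammer-cong : ∀ {s t} → s ≈ t → ∀ n → pochhammer s n ≈ pochhammer t n
  pochhammer-cong s≈t zero    = refl
  pochhammer-cong s≈t (suc n) = *-cong (pochhammer-cong s≈t n) (+-congʳ s≈t)

  binomial-cong : ∀ {s t} → s ≈ t → ∀ n → binomial s n ≈ binomial t n
  binomial-cong s≈t n = *-congʳ (pochhammer-cong s≈t n)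

  fromℕ-pos : ∀ n → .{{ℕ.NonZero n}} → 0# < fromℕ n
  fromℕ-pos (suc n) = pos+nonneg 0<1 (fromℕ-nonneg n)

  fromℕ-suc≉0 : ∀ n → fromℕ (suc n) ≉ 0#
  fromℕ-suc≉0 n = pos⇒≉0 (fromℕ-pos (suc n))

  fromℕ-!≉0 : ∀ n → fromℕ (n !) ≉ 0#
  fromℕ-!≉0 n = pos⇒≉0 (fromℕ-pos (n !) {{n ℕ.!≢0}})

  binomial-0 : ∀ s → binomial s 0 ≈ 1#
  binomial-0 s = trans (*-congˡ (⁻¹-cong (+-identityʳ 1#)))
    (⁻¹-inverseʳ 1# (λ 1≈0 → 0≉1 (sym 1≈0)))

  binomial-suc : ∀ s n → fromℕ (suc n) * binomial s (suc n) ≈ (s + fromℕ n) * binomial s n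
  binomial-suc s n = begin
    N * (P * (s + fromℕ n) * F' ⁻¹)   ≈⟨ solve 4 (λ N P t i → N :* (P :* t :* i) := t :* (P :* (N :* i))) refl
                                          N P (s + fromℕ n) (F' ⁻¹) ⟩
    (s + fromℕ n) * (P * (N * F' ⁻¹)) ≈⟨ *-congˡ (*-congˡ quotient-of-factorials) ⟩
    (s + fromℕ n) * (P * F ⁻¹)        ∎
    where
    N P F F' : Carrier
    N = fromℕ (suc n)
    P = pochhammer s n
    F = fromℕ (n !)
    F' = fromℕ (suc n !)
    quotient-of-factorials : N * F' ⁻¹ ≈ F ⁻¹
    quotient-of-factorials = *-cancelˡ (fromℕ-!≉0 n) (begin
      F * (N * F' ⁻¹)   ≈⟨ solve 3 (λ F N i → F :* (N :* i) := N :* F :* i) refl F N (F' ⁻¹) ⟩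
      N * F * F' ⁻¹     ≈⟨ *-congʳ (×1-homo-* (suc n) (n !)) ⟨
      F' * F' ⁻¹        ≈⟨ ⁻¹-inverseʳ F' (fromℕ-!≉0 (suc n)) ⟩
      1#                ≈⟨ ⁻¹-inverseʳ F (fromℕ-!≉0 n) ⟨
      F * F ⁻¹          ∎)

  pochhammer-shift : ∀ s n → s * pochhammer (s + 1#) n ≈ pochhammer s n * (s + fromℕ n)
  pochhammer-shift s zero    = solve 1 (λ s → s :* :1 := :1 :* (s :+ :0)) refl s
  pochhammer-shift s (suc n) = begin
    s * (pochhammer (s + 1#) n * (s + 1# + fromℕ n))
      ≈⟨ *-assoc _ _ _ ⟨
    s * pochhammer (s + 1#) n * (s + 1# + fromℕ n)
      ≈⟨ *-cong (pochhammer-shift s n) (+-assoc s 1# (fromℕ n)) ⟩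
    pochhammer s n * (s + fromℕ n) * (s + fromℕ (suc n)) ∎

  binomial-shift : ∀ s n → s * binomial (s + 1#) n ≈ fromℕ (suc n) * binomial s (suc n)
  binomial-shift s n = begin
    s * (pochhammer (s + 1#) n / fromℕ (n !))         ≈⟨ *-assoc _ _ _ ⟨
    s * pochhammer (s + 1#) n / fromℕ (n !)           ≈⟨ *-congʳ (trans (pochhammer-shift s n) (*-comm _ _)) ⟩
    (s + fromℕ n) * pochhammer s n / fromℕ (n !)      ≈⟨ *-assoc _ _ _ ⟩
    (s + fromℕ n) * binomial s n                      ≈⟨ binomial-suc s n ⟨
    fromℕ (suc n) * binomial s (suc n)                ∎

  -- (1 − x) (1 − x)⁻ˢ⁻¹ = (1 − x)⁻ˢ
  binomial-difference : ∀ s n → binomial (s + 1#) (suc n) ≈ binomial (s + 1#) n + binomial s (suc n)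
  binomial-difference s n = *-cancelˡ (fromℕ-suc≉0 n) (begin
    fromℕ (suc n) * binomial (s + 1#) (suc n)
      ≈⟨ binomial-suc (s + 1#) n ⟩
    (s + 1# + fromℕ n) * binomial (s + 1#) n
      ≈⟨ solve 3 (λ s k b → (s :+ :1 :+ k) :* b := (:1 :+ k) :* b :+ s :* b) refl s (fromℕ n) (binomial (s + 1#) n) ⟩
    fromℕ (suc n) * binomial (s + 1#) n + s * binomial (s + 1#) n
      ≈⟨ +-congˡ (binomial-shift s n) ⟩
    fromℕ (suc n) * binomial (s + 1#) n + fromℕ (suc n) * binomial s (suc n)
      ≈⟨ solve 3 (λ k b c → k :* b :+ k :* c := k :* (b :+ c)) refl (fromℕ (suc n)) _ _ ⟩
    fromℕ (suc n) * (binomial (s + 1#) n + binomial s (suc n)) ∎)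

  coeff-constant-⊛ : ∀ c (g : PowerSeries) n → (coeff (c ∷ []) ⊛ g) n ≈ c * g n
  coeff-constant-⊛ c g zero    = +-identityʳ _
  coeff-constant-⊛ c g (suc n) = trans (+-congˡ (⊛-zeroˡ g n)) (+-identityʳ _)

  -- In terms of generating functions: if W is the numerator of a series over
  -- (1 − x) to the power s, then step s α W is the numerator over the power
  -- s + 1 of the series with n-th coefficient multiplied by α + n.
  step-series : ∀ s α p n → (coeff (step s α p) ⊛ binomial (s + 1#)) n
                            ≈ (α + fromℕ n) * (coeff p ⊛ binomial s) n
  step-series s α []      n       =
    trans (⊛-zeroˡ (binomial (s + 1#)) n) (sym (trans (*-congˡ (⊛-zeroˡ (binomial s) n)) (zeroʳ _)))
  step-series s α (w ∷ p) zero    =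
    solve 3 (λ α w b → α :* w :* b :+ :0 := (α :+ :0) :* (w :* b :+ :0)) refl α w (binomial s 0)
  step-series s α (w ∷ p) (suc n) = begin
    α * w * C' + (coeff (((s - α) * w ∷ []) +ₚ step s (α + 1#) p) ⊛ binomial (s + 1#)) n
      ≈⟨ +-congˡ (⊛-congʳ (coeff (((s - α) * w ∷ []) +ₚ step s (α + 1#) p)) both (binomial (s + 1#))
           (coeff-+ ((s - α) * w ∷ []) (step s (α + 1#) p)) n) ⟩
    α * w * C' + (both ⊛ binomial (s + 1#)) n
      ≈⟨ +-congˡ (⊛-distribʳ (coeff ((s - α) * w ∷ [])) (coeff (step s (α + 1#) p)) (binomial (s + 1#)) n) ⟩
    α * w * C' + ((coeff ((s - α) * w ∷ []) ⊛ binomial (s + 1#)) n + (coeff (step s (α + 1#) p) ⊛ binomial (s + 1#)) n)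
      ≈⟨ +-congˡ (+-cong (coeff-constant-⊛ _ (binomial (s + 1#)) n) (step-series s (α + 1#) p n)) ⟩
    α * w * C' + ((s - α) * w * C + (α + 1# + k) * u)
      ≈⟨ +-congʳ (*-congˡ (binomial-difference s n)) ⟩
    α * w * (C + B') + ((s - α) * w * C + (α + 1# + k) * u)
      ≈⟨ regroup s α w k u B' C ⟩
    w * (s * C) + (α * w * B' + (α + 1# + k) * u)
      ≈⟨ +-congʳ (*-congˡ (binomial-shift s n)) ⟩
    w * ((1# + k) * B') + (α * w * B' + (α + 1# + k) * u)
      ≈⟨ solve 5 (λ α w k u b → w :* ((:1 :+ k) :* b) :+ (α :* w :* b :+ (α :+ :1 :+ k) :* u)
           := (α :+ (:1 :+ k)) :* (w :* b :+ u)) refl α w k u B' ⟩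
    (α + (1# + k)) * (w * B' + u) ∎
    where
    both : PowerSeries
    both k = coeff ((s - α) * w ∷ []) k + coeff (step s (α + 1#) p) k
    k u B' C C' : Carrier
    k = fromℕ n
    u = (coeff p ⊛ binomial s) n
    B' = binomial s (suc n)
    C = binomial (s + 1#) n
    C' = binomial (s + 1#) (suc n)
    regroup : ∀ s α w k u b c → α * w * (c + b) + ((s - α) * w * c + (α + 1# + k) * u)
                                ≈ w * (s * c) + (α * w * b + (α + 1# + k) * u)
    regroup = solve 7 (λ s α w k u b c → α :* w :* (c :+ b) :+ ((s :- α) :* w :* c :+ (α :+ :1 :+ k) :* u)
                                := w :* (s :* c) :+ (α :* w :* b :+ (α :+ :1 :+ k) :* u)) refl

  euler-series : ∀ a αs n → (coeff (euler a αs) ⊛ binomial (fromℕ (length αs) + a)) n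
                            ≈ eval (monicWithZeros (map -_ αs)) (fromℕ n) * binomial a n
  euler-series a []       n = begin
    (coeff (1# ∷ []) ⊛ binomial (0# + a)) n   ≈⟨ coeff-constant-⊛ 1# (binomial (0# + a)) n ⟩
    1# * binomial (0# + a) n                  ≈⟨ *-cong (solve 1 (λ k → :1 := :1 :+ k :* :0) refl (fromℕ n))
                                                   (binomial-cong (+-identityˡ a) n) ⟩
    (1# + fromℕ n * 0#) * binomial a n        ∎
  euler-series a (α ∷ αs) n = begin
    (coeff (step s α W) ⊛ binomial (1# + fromℕ (length αs) + a)) n
      ≈⟨ ⊛-congˡ (coeff (step s α W)) (binomial (1# + fromℕ (length αs) + a)) (binomial (s + 1#)) (binomial-cong
           (solve 2 (λ k a → :1 :+ k :+ a := k :+ a :+ :1) refl (fromℕ (length αs)) a)) n ⟩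
    (coeff (step s α W) ⊛ binomial (s + 1#)) n
      ≈⟨ step-series s α W n ⟩
    (α + fromℕ n) * (coeff W ⊛ binomial s) n
      ≈⟨ *-congˡ (euler-series a αs n) ⟩
    (α + fromℕ n) * (eval P (fromℕ n) * binomial a n)
      ≈⟨ solve 4 (λ α k u b → (α :+ k) :* (u :* b) := (k :- :- α) :* u :* b) refl α (fromℕ n) (eval P (fromℕ n)) _ ⟩
    (fromℕ n - - α) * eval P (fromℕ n) * binomial a n
      ≈⟨ *-congʳ (eval-linear (- α) P (fromℕ n)) ⟨
    eval (monicWithZeros (map -_ (α ∷ αs))) (fromℕ n) * binomial a n ∎
    where
    s : Carrier
    s = fromℕ (length αs) + a
    W P : Poly
    W = euler a αs
    P = monicWithZeros (map -_ αs)

  -- F is κ times the product of the X + α, hence its Eulerian polynomial is κ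
  -- times that of the product.
  eulerian-unique : ∀ a αs F w κ → F ≈ₚ κ ·ₚ monicWithZeros (map -_ αs) →
    IsEulerianPolynomial (length αs) a F w → w ≈ₚ κ ·ₚ euler a αs
  eulerian-unique a αs F w κ F≈ (_ , w-series) =
    ⊛-cancelʳ (binomial-0 s) (coeff w) (coeff (κ ·ₚ euler a αs)) λ n → begin
    (coeff w ⊛ binomial s) n
      ≈⟨ ⊛-congˡ (coeff w) (binomial s) ([1-x]^ (- s)) (binomial-cong (solve 1 (λ s → s := :- :- s) refl s)) n ⟩
    (coeff w ⊛ [1-x]^ (- s)) n
      ≈⟨ w-series n ⟨
    eval F (fromℕ n) * binomial a n
      ≈⟨ *-congʳ (trans (eval-cong F (κ ·ₚ P) (fromℕ n) F≈) (eval-· κ P (fromℕ n))) ⟩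
    κ * eval P (fromℕ n) * binomial a n
      ≈⟨ *-assoc _ _ _ ⟩
    κ * (eval P (fromℕ n) * binomial a n)
      ≈⟨ *-congˡ (euler-series a αs n) ⟨
    κ * (coeff (euler a αs) ⊛ binomial s) n
      ≈⟨ ⊛-scale κ (coeff (euler a αs)) (binomial s) n ⟨
    ((λ k → κ * coeff (euler a αs) k) ⊛ binomial s) n
      ≈⟨ ⊛-congʳ (coeff (κ ·ₚ euler a αs)) (λ k → κ * coeff (euler a αs) k) (binomial s) (coeff-· κ (euler a αs)) n ⟨
    (coeff (κ ·ₚ euler a αs) ⊛ binomial s) n ∎
    where
    s : Carrier
    s = fromℕ (length αs) + a
    P : Poly
    P = monicWithZeros (map -_ αs)

-- Real polynomials with real zeros, viewed over the complex numbers

module RealZeros (ℝ : CompleteOrderedField) where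
  open CompleteOrderedField ℝ
  open Eulerian ℝ
  open OrderedField ℝ
  open PolynomialAlgebra ℝ

  infix 4 _∼_
  -- The complex number z is the real number x. The operations on polynomials
  -- respect this relation between coefficients.
  _∼_ : ℂ → Carrier → Set
  z ∼ x = re z ≈ x × im z ≈ 0#

  +-∼ : ∀ {z w x y} → z ∼ x → w ∼ y → ((re z + re w) +i (im z + im w)) ∼ x + y
  +-∼ (re-z , im-z) (re-w , im-w) = +-cong re-z re-w , trans (+-cong im-z im-w) (+-identityˡ 0#)

  *-∼ : ∀ {z w x y} → z ∼ x → w ∼ y → ((re z * re w - im z * im w) +i (re z * im w + im z * re w)) ∼ x * y
  *-∼ (re-z , im-z) (re-w , im-w) =
    trans (+-cong (*-cong re-z re-w) (-‿cong (*-cong im-z im-w)))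
      (solve 2 (λ x y → x :* y :- :0 :* :0 := x :* y) refl _ _) ,
    trans (+-cong (*-cong re-z im-w) (*-cong im-z re-w)) (solve 2 (λ x y → x :* :0 :+ :0 :* y := :0) refl _ _)

  neg-∼ : ∀ {z x} → z ∼ x → ((- re z) +i (- im z)) ∼ - x
  neg-∼ (re-z , im-z) = -‿cong re-z , trans (-‿cong im-z) (solve 0 (:- :0 := :0) refl)

  ofReal-∼ : ∀ x → ofReal x ∼ x
  ofReal-∼ x = refl , refl

  map-ofReal-∼ : ∀ xs → Pointwise _∼_ (map ofReal xs) xs
  map-ofReal-∼ []       = []
  map-ofReal-∼ (x ∷ xs) = ofReal-∼ x ∷ map-ofReal-∼ xs

  +ₚ-∼ : ∀ {p q p' q'} → Pointwise _∼_ p p' → Pointwise _∼_ q q' → Pointwise _∼_ (p ℂ[X].+ₚ q) (p' +ₚ q')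
  +ₚ-∼ []      q∼      = q∼
  +ₚ-∼ (a ∷ p) []      = a ∷ p
  +ₚ-∼ (a ∷ p) (b ∷ q) = +-∼ a b ∷ +ₚ-∼ p q

  ·ₚ-∼ : ∀ {c c' p p'} → c ∼ c' → Pointwise _∼_ p p' → Pointwise _∼_ (c ℂ[X].·ₚ p) (c' ·ₚ p')
  ·ₚ-∼ c []      = []
  ·ₚ-∼ c (a ∷ p) = *-∼ c a ∷ ·ₚ-∼ c p

  *ₚ-∼ : ∀ {p q p' q'} → Pointwise _∼_ p p' → Pointwise _∼_ q q' → Pointwise _∼_ (p ℂ[X].*ₚ q) (p' *ₚ q')
  *ₚ-∼ []      q = []
  *ₚ-∼ (a ∷ p) q = +ₚ-∼ (·ₚ-∼ a q) (ofReal-∼ 0# ∷ *ₚ-∼ p q)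

  monic-∼ : ∀ {zs xs} → Pointwise _∼_ zs xs → Pointwise _∼_ (ℂ[X].monicWithZeros zs) (monicWithZeros xs)
  monic-∼ []       = ofReal-∼ 1# ∷ []
  monic-∼ (z ∷ zs) = *ₚ-∼ (neg-∼ z ∷ ofReal-∼ 1# ∷ []) (monic-∼ zs)

  coeff-∼ : ∀ {p p'} → Pointwise _∼_ p p' → ∀ n → ℂ[X].coeff p n ∼ coeff p' n
  coeff-∼ []      n       = ofReal-∼ 0#
  coeff-∼ (a ∷ p) zero    = a
  coeff-∼ (a ∷ p) (suc n) = coeff-∼ p n

  real⇒complex-zeros : ∀ w rs → FactorsWithZeros w rs → ComplexZeros w (map ofReal rs)
  real⇒complex-zeros w rs (c , c≉0 , w≈) = ofReal c , (λ (c≈0 , _) → c≉0 c≈0) , λ n →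
    let (re-w , im-w) = coeff-∼ (map-ofReal-∼ w) n
        (re-c , im-c) = coeff-∼ (·ₚ-∼ (ofReal-∼ c) (monic-∼ (map-ofReal-∼ rs))) n
    in trans re-w (trans (w≈ n) (sym re-c)) , trans im-w (sym im-c)

  coeff-·-re : ∀ c {p p'} → Pointwise _∼_ p p' → ∀ n → re (ℂ[X].coeff (c ℂ[X].·ₚ p) n) ≈ re c * coeff p' n
  coeff-·-re c []                      n       = sym (zeroʳ _)
  coeff-·-re c ((re-a , im-a) ∷ p)     zero    = trans (+-cong (*-congˡ re-a) (-‿cong (*-congˡ im-a)))
    (solve 3 (λ c d a → c :* a :- d :* :0 := c :* a) refl (re c) (im c) _)
  coeff-·-re c (_ ∷ p)                 (suc n) = coeff-·-re c p n

  -- As F and the product over the zeros are real, the constant factor may be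
  -- replaced by its real part.
  complex⇒real-factors : ∀ F {zs xs} → Pointwise _∼_ zs xs → ComplexZeros F zs → ∃[ κ ] F ≈ₚ κ ·ₚ monicWithZeros xs
  complex⇒real-factors F {xs = xs} zs∼xs (c , _ , F≈) = re c , λ n →
    trans (sym (proj₁ (coeff-∼ (map-ofReal-∼ F) n)))
      (trans (proj₁ (F≈ n)) (trans (coeff-·-re c (monic-∼ zs∼xs) n) (sym (coeff-· (re c) (monicWithZeros xs) n))))

-- The zeros of a general Eulerian polynomial

module ZeroLocations (ℝ : CompleteOrderedField) where
  open CompleteOrderedField ℝ
  open Eulerian ℝ
  open OrderedField ℝ
  open PolynomialAlgebra ℝ
  open IntermediateValue ℝ
  open EulerianZeros ℝ
  open Series ℝ
  open RealZeros ℝ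
  open import Relation.Binary.Reasoning.Setoid setoid

  scale-factors : ∀ κ V w rs → κ ≉ 0# → w ≈ₚ κ ·ₚ V → FactorsWithZeros V rs → FactorsWithZeros w rs
  scale-factors κ V w rs κ≉0 w≈ (c , c≉0 , V≈) = κ * c , (λ κc≈0 → c≉0 (*-cancelˡ κ≉0 (trans κc≈0 (sym (zeroʳ κ))))) ,
    λ n → begin
      coeff w n                                ≈⟨ w≈ n ⟩
      coeff (κ ·ₚ V) n                         ≈⟨ coeff-· κ V n ⟩
      κ * coeff V n                            ≈⟨ *-congˡ (trans (V≈ n) (coeff-· c (monicWithZeros rs) n)) ⟩
      κ * (c * coeff (monicWithZeros rs) n)    ≈⟨ *-assoc _ _ _ ⟨
      κ * c * coeff (monicWithZeros rs) n      ≈⟨ coeff-· (κ * c) (monicWithZeros rs) n ⟨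
      coeff ((κ * c) ·ₚ monicWithZeros rs) n   ∎

  -- Both assertions about the zeros of w, for degree m and parameter a.
  ZeroLocation : ℕ → Carrier → Poly → Set
  ZeroLocation m a w =
    ( a < 1# - fromℕ m →
      Σ[ rs ∈ List Carrier ] (ComplexZeros w (map ofReal rs) × All (λ r → 1# < r) rs) )
    ×
    ( 1# - fromℕ m < a → a < fromℕ 2 - fromℕ m →
      Σ[ r ∈ Carrier ] Σ[ rs ∈ List Carrier ]
        (ComplexZeros w (map ofReal (r ∷ rs)) × (0# < r × r < 1#) × All (λ x → 1# < x) rs) )

  zero-location : ∀ a F αs κ w → 2 ℕ.≤ length αs → eval F 0# ≈ 1# → F ≈ₚ κ ·ₚ monicWithZeros (map -_ αs) →
    IsEulerianPolynomial (length αs) a F w → All (_< a) αs →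
    ZeroLocation (length αs) a w
  zero-location a F (_ ∷ []) κ w (ℕ.s≤s ())
  zero-location a F (α ∷ αs@(_ ∷ βs)) κ w _ F0≈1 F≈ w-eulerian αs<a@(α<a ∷ αs'<a) = part-i , part-ii
    where
    V P : Poly
    V = euler a (α ∷ αs)
    P = monicWithZeros (map -_ (α ∷ αs))
    n : ℕ
    n = length βs
    w≈ : w ≈ₚ κ ·ₚ V
    w≈ = eulerian-unique a (α ∷ αs) F w κ F≈ w-eulerian
    κ≉0 : κ ≉ 0#
    κ≉0 κ≈0 = 0≉1 (trans (sym (trans (*-congʳ κ≈0) (zeroˡ _)))
      (trans (sym (trans (eval-cong F (κ ·ₚ P) 0# F≈) (eval-· κ P 0#))) F0≈1))

    part-i : a < 1# - fromℕ (length (α ∷ αs)) →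
      Σ[ rs ∈ List Carrier ] (ComplexZeros w (map ofReal rs) × All (λ r → 1# < r) rs)
    part-i a< = zeros , real⇒complex-zeros w zeros (scale-factors κ V w zeros κ≉0 w≈
        (factors V zeros (≡.subst (DegreeAtMost V) (≡.sym number) (euler-degree a (α ∷ αs)))
          (descending⇒distinct descending) are-zeros (same-sign⇒≉0 same-sign))) , above-1
      where
      s<1 : fromℕ (length (α ∷ αs)) + a < 1#
      s<1 = by-gap (solve 2 (λ k a → (:1 :- k) :- a := :1 :- (k :+ a)) refl (fromℕ (length (α ∷ αs))) a) (gap a<)
      a<0 : a < 0#
      a<0 = by-gap (solve 2 (λ k a → ((:1 :- (:1 :+ k)) :- a) :+ k := :0 :- a) refl (fromℕ (suc n)) a)
        (pos+nonneg (gap a<) (fromℕ-nonneg (suc n)))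
      open DistinctZerosAbove1 (euler-zeros a (α ∷ αs) a<0 αs<a s<1)

    part-ii : 1# - fromℕ (length (α ∷ αs)) < a → a < fromℕ 2 - fromℕ (length (α ∷ αs)) →
      Σ[ r ∈ Carrier ] Σ[ rs ∈ List Carrier ]
        (ComplexZeros w (map ofReal (r ∷ rs)) × (0# < r × r < 1#) × All (λ x → 1# < x) rs)
    part-ii <a a< =
      let (r , rs , 0<r , r<1 , 1<rs , len , distinct , Vrs , V0≉0) =
            zeros-last-step a α (euler a αs) (length αs) a<0 α<a 0<s (euler-degree a αs)
              (euler-zeros a αs a<0 αs'<a s<1)
          r≉rs = All.map (λ 1<x r≈x → <-irrefl (<-trans 1<x (<-respˡ-≈ r≈x r<1))) 1<rs
      in r , rs ,
         real⇒complex-zeros w (r ∷ rs) (scale-factors κ V w (r ∷ rs) κ≉0 w≈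
           (factors V (r ∷ rs) (≡.subst (λ k → DegreeAtMost V (suc k)) (≡.sym len) (euler-degree a (α ∷ αs)))
             (r≉rs ∷ distinct) Vrs V0≉0)) ,
         (0<r , r<1) , 1<rs
      where
      s<1 : fromℕ (length αs) + a < 1#
      s<1 = by-gap (solve 2 (λ k a → (:1 :+ (:1 :+ :0)) :- (:1 :+ k) :- a := :1 :- (k :+ a)) refl (fromℕ (suc n)) a)
        (gap a<)
      0<s : 0# < fromℕ (length αs) + a
      0<s = pos-resp (solve 2 (λ k a → a :- (:1 :- (:1 :+ k)) := k :+ a) refl (fromℕ (suc n)) a) (gap <a)
      a<0 : a < 0#
      a<0 = by-gap
        (solve 2 (λ k a → ((:1 :+ (:1 :+ :0)) :- (:1 :+ (:1 :+ k)) :- a) :+ k := :0 :- a) refl (fromℕ n) a)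
        (pos+nonneg (gap a<) (fromℕ-nonneg n))

theorem4 :
    (ℝ : CompleteOrderedField) →
    let open CompleteOrderedField ℝ
        open Eulerian ℝ in
    (m : ℕ) → 2 ℕ.≤ m →
    (a : Carrier) (F : Poly) (α : Fin m → Carrier) →
    HasDegree F m →
    eval F 0# ≈ 1# →
    ComplexZeros F (tabulate (λ j → ofReal (- α j))) →
    (w : Poly) → IsEulerianPolynomial m a F w →
    ( (∀ j → α j < a) → a < 1# - fromℕ m →
      Σ[ rs ∈ List Carrier ]
        (ComplexZeros w (map ofReal rs) × All (λ r → 1# < r) rs) )
    ×
    ( 1# - fromℕ m < a → a < fromℕ 2 - fromℕ m → (∀ j → α j < a) →
      Σ[ r ∈ Carrier ] Σ[ rs ∈ List Carrier ]
        (ComplexZeros w (map ofReal (r ∷ rs)) ×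
         (0# < r × r < 1#) × All (λ x → 1# < x) rs) )
theorem4 ℝ m 2≤m a F α _ F0≈1 F-zeros w w-eulerian =
  (λ α<a → proj₁ (main α<a)) , (λ <a a< α<a → proj₂ (main α<a) <a a<)
  where
  open CompleteOrderedField ℝ
  open Eulerian ℝ
  open RealZeros ℝ
  open ZeroLocations ℝ
  αs : List Carrier
  αs = tabulate α
  m≡ : m ≡ length αs
  m≡ = ≡.sym (length-tabulate α)
  zeros∼ : Pointwise _∼_ (tabulate (λ j → ofReal (- α j))) (map -_ αs)
  zeros∼ = ≡.subst (Pointwise _∼_ _) (≡.sym (map-tabulate α (λ x → - x))) (Pointwise.tabulate⁺ (λ j → ofReal-∼ (- α j)))
  F-factors : ∃[ κ ] F ≈ₚ κ ·ₚ monicWithZeros (map -_ αs)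
  F-factors = complex⇒real-factors F zeros∼ F-zeros
  main : (∀ j → α j < a) → ZeroLocation m a w
  main α<a = ≡.subst (λ k → ZeroLocation k a w) (≡.sym m≡)
    (zero-location a F αs (proj₁ F-factors) w (≡.subst (2 ℕ.≤_) m≡ 2≤m) F0≈1 (proj₂ F-factors)
      (≡.subst (λ k → IsEulerianPolynomial k a F w) m≡ w-eulerian) (All.tabulate⁺ α<a))
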